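{- Let $p$ be a prime, $k\ge 1$, and $q=p^k$. Every integer group determinant $D$ of the group $GA(1,q)$ can be written in the form $$D=AB^{q-1},$$ where $A$ is a $\mathbb Z_{q-1}$ integer group determinant and $B$ is an integer with $B\equiv A \pmod q$.
   Context: For a finite group $G=\{g_1,\dots,g_n\}$ and an element $\sum_{g\in G}a_g g$ of the group ring $\mathbb Z[G]$ (all $a_g\in\mathbb Z$), the group determinant is $D\left(\sum_{g\in G}a_g g\right)=\det\left(a_{g_ig_j^{ -1}}\right)_{i,j=1}^n$. An integer group determinant of $G$ is any integer of this form (with integer coefficients $a_g$). A $\mathbb Z_m$ integer group determinant (or $\mathbb Z_m$ integer determinant) is an integer group determinant of the cyclic group $\mathbb Z_m$; equivalently, an integer of the form $\prod_{x^m=1}f(x)$ for some $f\in\mathbb Z[x]$, the product being over all complex $m$-th roots of unity. The general affine group of degree one over $\mathbb F_q$ is $GA(1,q)=\left\{\begin{pmatrix} a & b\\ 0 & 1\end{pmatrix}: a\in\mathbb F_q^*,\ b\in\mathbb F_q\right\}$ under matrix multiplication, i.e. the semidirect product $\mathbb F_q\rtimes\mathbb F_q^*$ with $\mathbb F_q^*$ acting by multiplication; it has order $q(q-1)$. -}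

module Defs where

open import Level using (Level; _⊔_; 0ℓ)
open import Algebra.Bundles using (Group; CommutativeRing)
open import Algebra.Apartness.Bundles using (HeytingCommutativeRing; HeytingField)
import Algebra.Apartness.Properties.HeytingCommutativeRing as HeytingProperties
import Algebra.Properties.Ring as RingProperties
open import Data.Fin.Base using (Fin; zero; suc; toℕ)
open import Data.Integer.Base as ℤ using (ℤ; +_; 0ℤ; 1ℤ; -1ℤ)
import Data.Integer.Properties as ℤ
open import Data.Integer.Divisibility.Signed
  using (_∣_; divides; ∣m∣n⇒∣m+n; ∣m⇒∣-m)
open import Data.Integer.Tactic.RingSolver using (solve-∀)
open import Data.Nat.Base using (ℕ; zero; suc)
open import Data.Product.Base using (Σ-syntax; ∃-syntax; _×_; _,_; proj₁; proj₂)
open import Data.Vec.Functional using (removeAt)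
open import Function.Bundles using (Func; Inverse)
open import Relation.Binary.Bundles using (Setoid)
open import Relation.Binary.PropositionalEquality as ≡ using (_≡_)
import Relation.Binary.Reasoning.Setoid as ≈-Reasoning

private variable
  c ℓ ℓ₁ ℓ₂ : Level
  n : ℕ

open import Algebra.Properties.Monoid.Sum ℤ.+-0-monoid using () renaming (sum to ∑)

-- Laplace expansion along the first row.
det : (Fin n → Fin n → ℤ) → ℤ
det {zero}  M = 1ℤ
det {suc n} M =
  ∑ λ j → -1ℤ ℤ.^ toℕ j ℤ.* M zero j ℤ.* det (λ i → removeAt (M (suc i)) j)

Enumeration : ℕ → Setoid c ℓ → Set (c ⊔ ℓ)
Enumeration n S = Inverse (≡.setoid (Fin n)) S

module _ (G : Group c ℓ) where
  open Group G

  -- The family of coefficients of an element of ℤ[G]; as G is a setoid, it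
  -- has to respect the equality of G.
  Coefficients : Set (c ⊔ ℓ)
  Coefficients = Func setoid (≡.setoid ℤ)

  groupDeterminant : Enumeration n setoid → Coefficients → ℤ
  groupDeterminant g a =
    det λ i j → Func.to a (Inverse.to g i ∙ Inverse.to g j ⁻¹)

  IsIntegerGroupDeterminant : ℤ → Set (c ⊔ ℓ)
  IsIntegerGroupDeterminant D =
    ∃[ n ] Σ[ g ∈ Enumeration n setoid ] Σ[ a ∈ Coefficients ]
      D ≡ groupDeterminant g a

infix 4 _≡_[mod_]

_≡_[mod_] : ℤ → ℤ → ℕ → Set
x ≡ y [mod m ] = + m ∣ x ℤ.- y

-- The integers with congruence modulo m as equality.
ℤ/ : ℕ → Group 0ℓ 0ℓ
ℤ/ m = record
  { Carrier = ℤ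
  ; _≈_     = λ x y → x ≡ y [mod m ]
  ; _∙_     = ℤ._+_
  ; ε       = 0ℤ
  ; _⁻¹     = ℤ.-_
  ; isGroup = record
    { isMonoid = record
      { isSemigroup = record
        { isMagma = record
          { isEquivalence = record
            { refl  = λ {x} → reflexive (≡.refl {x = x})
            ; sym   = λ {x} {y} x≡y →
                ≡.subst (+ m ∣_) (negate x y) (∣m⇒∣-m x≡y)
            ; trans = λ {x} {y} {z} x≡y y≡z →
                ≡.subst (+ m ∣_) (telescope x y z) (∣m∣n⇒∣m+n x≡y y≡z)
            }
          ; ∙-cong = λ {x} {y} {u} {v} x≡y u≡v →
              ≡.subst (+ m ∣_) (add x y u v) (∣m∣n⇒∣m+n x≡y u≡v)
          }
        ; assoc = λ x y z → reflexive (ℤ.+-assoc x y z)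
        }
      ; identity = (λ x → reflexive (ℤ.+-identityˡ x))
                 , (λ x → reflexive (ℤ.+-identityʳ x))
      }
    ; inverse = (λ x → reflexive (ℤ.+-inverseˡ x))
              , (λ x → reflexive (ℤ.+-inverseʳ x))
    ; ⁻¹-cong = λ {x} {y} x≡y →
        ≡.subst (+ m ∣_) (neg x y) (∣m⇒∣-m x≡y)
    }
  }
  where
  reflexive : ∀ {x y} → x ≡ y → x ≡ y [mod m ]
  reflexive {x} ≡.refl = divides 0ℤ (ℤ.+-inverseʳ x)

  negate : ∀ x y → ℤ.- (x ℤ.- y) ≡ y ℤ.- x
  negate = solve-∀

  telescope : ∀ x y z → (x ℤ.- y) ℤ.+ (y ℤ.- z) ≡ x ℤ.- z
  telescope = solve-∀

  add : ∀ x y u v → (x ℤ.- y) ℤ.+ (u ℤ.- v) ≡ (x ℤ.+ u) ℤ.- (y ℤ.+ v)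
  add = solve-∀

  neg : ∀ x y → ℤ.- (x ℤ.- y) ≡ (ℤ.- x) ℤ.- (ℤ.- y)
  neg = solve-∀

module _ (F : HeytingField c ℓ₁ ℓ₂) where
  open HeytingField F
  open HeytingProperties heytingCommutativeRing
    using (x-0≈x; 1#0; x#0y#0→xy#0; invertibleˡ⇒#)
  open RingProperties (CommutativeRing.ring
      (HeytingCommutativeRing.commutativeRing heytingCommutativeRing))
    using (-‿distribʳ-*)
  open ≈-Reasoning setoid

  -- The matrix with rows (a b) and (0 1), a being invertible.
  record AffineMatrix : Set (c ⊔ ℓ₂) where
    constructor affine
    field
      a   : Carrier
      b   : Carrier
      a#0 : a # 0#

  module Affine where
    open AffineMatrix

    inverse#0 : ∀ {x} → x # 0# → ∃[ y ] y * x ≈ 1# × y # 0#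
    inverse#0 {x} x#0 with #⇒invertible x#0
    ... | y , y[x-0]≈1 , _ = y , yx≈1 , invertibleˡ⇒# (x , (begin
        x * (y - 0#) ≈⟨ *-congˡ (x-0≈x y) ⟩
        x * y        ≈⟨ *-comm x y ⟩
        y * x        ≈⟨ yx≈1 ⟩
        1#           ∎))
      where
      yx≈1 : y * x ≈ 1#
      yx≈1 = trans (*-congˡ (sym (x-0≈x x))) y[x-0]≈1

    inv : ∀ {x} → x # 0# → Carrier
    inv x#0 = proj₁ (inverse#0 x#0)

    inv-* : ∀ {x} (x#0 : x # 0#) → inv x#0 * x ≈ 1#
    inv-* x#0 = proj₁ (proj₂ (inverse#0 x#0))

    inv-unique : ∀ {x y z} (x#0 : x # 0#) → y ≈ x → z * y ≈ 1# → z ≈ inv x#0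
    inv-unique {x} {y} {z} x#0 y≈x zy≈1 = begin
      z                   ≈⟨ *-identityʳ z ⟨
      z * 1#              ≈⟨ *-congˡ (trans (*-comm x _) (inv-* x#0)) ⟨
      z * (x * inv x#0)   ≈⟨ *-assoc z x _ ⟨
      z * x * inv x#0     ≈⟨ *-congʳ (trans (*-congˡ (sym y≈x)) zy≈1) ⟩
      1# * inv x#0        ≈⟨ *-identityˡ _ ⟩
      inv x#0             ∎

    _≋_ : AffineMatrix → AffineMatrix → Set ℓ₁
    M ≋ N = a M ≈ a N × b M ≈ b N

    -- (a b; 0 1)(a′ b′; 0 1) = (aa′ ab′+b; 0 1)
    _⊙_ : AffineMatrix → AffineMatrix → AffineMatrix
    affine a b a#0 ⊙ affine a′ b′ a′#0 =
      affine (a * a′) (a * b′ + b) (x#0y#0→xy#0 a#0 a′#0)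

    𝟙 : AffineMatrix
    𝟙 = affine 1# 0# 1#0

    _⁻¹ : AffineMatrix → AffineMatrix
    affine a b a#0 ⁻¹ =
      affine (inv a#0) (- (inv a#0 * b)) (proj₂ (proj₂ (inverse#0 a#0)))

    ⊙-assoc : ∀ L M N → ((L ⊙ M) ⊙ N) ≋ (L ⊙ (M ⊙ N))
    ⊙-assoc (affine a b _) (affine a′ b′ _) (affine a″ b″ _) =
      *-assoc a a′ a″ , (begin
        a * a′ * b″ + (a * b′ + b)   ≈⟨ +-assoc _ _ _ ⟨
        a * a′ * b″ + a * b′ + b     ≈⟨ +-congʳ (+-congʳ (*-assoc a a′ b″)) ⟩
        a * (a′ * b″) + a * b′ + b   ≈⟨ +-congʳ (distribˡ a _ b′) ⟨
        a * (a′ * b″ + b′) + b       ∎)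

    ⁻¹-inverseˡ : ∀ M → ((M ⁻¹) ⊙ M) ≋ 𝟙
    ⁻¹-inverseˡ (affine a b a#0) = inv-* a#0 , -‿inverseʳ _

    ⁻¹-inverseʳ : ∀ M → (M ⊙ (M ⁻¹)) ≋ 𝟙
    ⁻¹-inverseʳ (affine a b a#0) = a*inv≈1 , (begin
        a * - (inv a#0 * b) + b     ≈⟨ +-congʳ (-‿distribʳ-* a _) ⟨
        - (a * (inv a#0 * b)) + b   ≈⟨ +-congʳ (-‿cong (*-assoc a _ b)) ⟨
        - (a * inv a#0 * b) + b     ≈⟨ +-congʳ (-‿cong (*-congʳ a*inv≈1)) ⟩
        - (1# * b) + b              ≈⟨ +-congʳ (-‿cong (*-identityˡ b)) ⟩
        - b + b                     ≈⟨ -‿inverseˡ b ⟩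
        0#                          ∎)
      where
      a*inv≈1 : a * inv a#0 ≈ 1#
      a*inv≈1 = trans (*-comm a _) (inv-* a#0)

    ⁻¹-≋ : ∀ {M N} → M ≋ N → (M ⁻¹) ≋ (N ⁻¹)
    ⁻¹-≋ {affine a b a#0} {affine a′ b′ a′#0} (a≈a′ , b≈b′) =
      inv≈ , -‿cong (*-cong inv≈ b≈b′)
      where
      inv≈ : inv a#0 ≈ inv a′#0
      inv≈ = inv-unique a′#0 a≈a′ (inv-* a#0)

  open Affine

  GA₁ : Group (c ⊔ ℓ₂) ℓ₁
  GA₁ = record
    { Carrier = AffineMatrix
    ; _≈_     = _≋_
    ; _∙_     = _⊙_
    ; ε       = 𝟙
    ; _⁻¹     = _⁻¹
    ; isGroup = record
      { isMonoid = record
        { isSemigroup = record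
          { isMagma = record
            { isEquivalence = record
              { refl  = refl , refl
              ; sym   = λ (p , q) → sym p , sym q
              ; trans = λ (p , q) (p′ , q′) → trans p p′ , trans q q′
              }
            ; ∙-cong = λ (p , q) (p′ , q′) →
                *-cong p p′ , +-cong (*-cong p q′) q
            }
          ; assoc = ⊙-assoc
          }
        ; identity =
            (λ M → *-identityˡ _ , trans (+-identityʳ _) (*-identityˡ _))
          , (λ M → *-identityʳ _ , trans (+-congʳ (zeroʳ _)) (+-identityˡ _))
        }
      ; inverse = ⁻¹-inverseˡ , ⁻¹-inverseʳ
      ; ⁻¹-cong = ⁻¹-≋
      }
    }

-- Over a finite field x # y is equivalent to ¬ x ≈ y: invertibility of x - y is
-- decided by a finite search, and # is tight.
HasOrder : HeytingField c ℓ₁ ℓ₂ → ℕ → Set (c ⊔ ℓ₁)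
HasOrder F q = Enumeration q (HeytingField.setoid F)

{-# OPTIONS --safe #-}
-- Let F have q = N + 1 elements.  Writing the elements of GA(1,q) as (x, xs) with
-- x ∈ F* and s ∈ F turns the group matrix into an N × N block matrix whose (x, y) block
-- is convolution with an element β x y of ℤ[F].  The characters of F split ℤ[F] into q
-- pieces; instead of complex characters we use s ↦ [cs], c ∈ F, with values in
-- ℤ[F] / (∑ₛ [s]), where their orthogonality relations hold.  Hence in that ring the
-- determinant is ∏_c c_*(C), where C = det β ∈ ℤ[F] and c_* is induced by [s] ↦ [cs].
-- For c ≠ 0, applying c_* to β only permutes rows and columns, so c_*(C) = C; thus the
-- coefficients of C at nonzero elements agree and C ≡ B := C₀ - C₁ modulo ∑ₛ [s].
-- For c = 0 one obtains the augmentation A = C₀ + N C₁, which is a determinant of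
-- F* ≅ ℤ/N.  So the determinant is A Bᴺ, and A - B = q C₁.
module Submission where

open import Algebra.Apartness.Bundles using (HeytingCommutativeRing; HeytingField)
import Algebra.Apartness.Properties.HeytingCommutativeRing as HeytingProperties
open import Algebra.Bundles using (CommutativeRing; CommutativeSemiring; Group; RawRing)
import Algebra.Morphism.RingMonomorphism as RingMonomorphism
open import Algebra.Morphism.Structures using (IsRingHomomorphism; IsRingMonomorphism)
import Algebra.Properties.CommutativeMonoid.Sum as CommutativeMonoidSum
import Algebra.Properties.Semiring.Sum as SemiringSum
open import Algebra.Structures using (IsCommutativeRing)
open import Data.Fin.Base
  using (Fin; zero; suc; toℕ; fromℕ<; punchIn; punchOut; _↑ˡ_; _↑ʳ_; splitAt; combine; quotient; remainder)
open import Data.Fin.Permutation as Perm using (Permutation; _⟨$⟩ʳ_; _⟨$⟩ˡ_)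
import Data.Fin.Properties as Fin
open import Data.Integer.Base as ℤ using (ℤ; 0ℤ; 1ℤ)
import Data.Integer.DivMod as ℤ
import Data.Integer.Divisibility.Signed as ℤ∣
import Data.Integer.Properties as ℤ
open import Data.Integer.Tactic.RingSolver using (solve-∀)
open import Data.Nat.Base as ℕ using (ℕ; zero; suc; _≤_; _<_; _≥_; z≤n; s≤s)
open import Data.Nat.Coprimality as Coprimality using (Coprime; coprime-divisor; coprime-Bézout)
open import Data.Nat.Divisibility as ℕ∣ using (_∣_; divides; _∣?_)
open import Data.Nat.GCD using (module Bézout)
open import Data.Nat.Induction using (<-rec)
open import Data.Nat.ListAction using (product)
open import Data.Nat.Primality using (Prime; prime⇒irreducible; prime⇒nonTrivial)
open import Data.Nat.Primality.Factorisation using (factorise)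
import Data.Nat.Properties as ℕ
open import Data.Product.Base using (_×_; _,_; proj₁; proj₂; ∃-syntax; ∃₂; Σ-syntax)
open import Data.Sum.Base using (inj₁; inj₂; [_,_])
open import Function.Base using (_∘_; const)
open import Function.Bundles using (Func; Inverse)
import Function.Construct.Composition as Composition
import Function.Construct.Symmetry as Symmetry
open import Function.Definitions using (Injective)
open import Level using (0ℓ; _⊔_)
open import Relation.Binary.PropositionalEquality as ≡ using (_≡_; _≢_; _≗_)
import Relation.Binary.Reasoning.Setoid as ≈-Reasoning
open import Relation.Nullary using (¬_; yes; no; contradiction)

-- Determinants over a commutative ring

-- Indexed by c ∈ F, these characters exist for every finite field alike, so neither roots of unity
-- nor a trace to the prime field has to be constructed. They are orthogonal because for u ≠ 0 the
-- map c ↦ cu permutes F, so that the sum of all [cu] is exactly the element set to zero. The price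
-- is that the character table is invertible only up to the factor q. Diagonalisation therefore
-- yields an equation of determinants multiplied by a power of q, which must be cancelled in the
-- quotient. This is possible since f - g is constant as soon as z(f - g) is, for an integer z ≠ 0.
-- The final equation descends to integers because ℤ embeds in the quotient, F having an element
-- other than 0. The determinants on the way have entries in ℤ[F] and in its quotient, hence the
-- theory over an arbitrary commutative ring. Recognising A as a determinant of ℤ/N needs a
-- generator of F*, which comes from counting roots of polynomials. The coordinates may be chosen
-- freely, as a group determinant does not depend on the enumeration.

module Summation {c ℓ} (R : CommutativeRing c ℓ) where
  open CommutativeRing R hiding (zero)
  private
    module S = SemiringSum semiring
    variable
      m n : ℕ

  -- Opaque, so that the summand can be inferred from a sum of known length.
  opaque
    ∑ : (Fin n → Carrier) → Carrier
    ∑ = S.sum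

    ∑-unfold : (f : Fin n → Carrier) → ∑ f ≡ S.sum f
    ∑-unfold f = ≡.refl

    ∑-empty : (f : Fin 0 → Carrier) → ∑ f ≈ 0#
    ∑-empty f = refl

    ∑-suc : (f : Fin (suc n) → Carrier) → ∑ f ≈ f zero + ∑ (f ∘ suc)
    ∑-suc f = refl

    ∑-cong : {f g : Fin n → Carrier} → (∀ i → f i ≈ g i) → ∑ f ≈ ∑ g
    ∑-cong = S.sum-cong-≋

    ∑-+ : (f g : Fin n → Carrier) → ∑ (λ i → f i + g i) ≈ ∑ f + ∑ g
    ∑-+ = S.∑-distrib-+

    *-∑ : ∀ x (f : Fin n → Carrier) → x * ∑ f ≈ ∑ (λ i → x * f i)
    *-∑ = S.*-distribˡ-sum

    ∑-* : ∀ x (f : Fin n → Carrier) → ∑ f * x ≈ ∑ (λ i → f i * x)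
    ∑-* = S.*-distribʳ-sum

    ∑-comm : (f : Fin m → Fin n → Carrier) → ∑ (λ i → ∑ (f i)) ≈ ∑ (λ j → ∑ λ i → f i j)
    ∑-comm = S.∑-comm

    ∑-permute : (f : Fin n → Carrier) (π : Permutation m n) → ∑ f ≈ ∑ (f ∘ (π ⟨$⟩ʳ_))
    ∑-permute = S.sum-permute

    ∑-split : ∀ m n (f : Fin (m ℕ.+ n) → Carrier) → ∑ f ≈ ∑ (λ i → f (i ↑ˡ n)) + ∑ (λ j → f (m ↑ʳ j))
    ∑-split zero    n f = sym (+-identityˡ _)
    ∑-split (suc m) n f = trans (+-congˡ (∑-split m n (f ∘ suc))) (sym (+-assoc _ _ _))

    ∑-0 : ∑ {n} (λ _ → 0#) ≈ 0#
    ∑-0 {n} = S.sum-replicate-zero n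

  ∑-combine : ∀ m n (f : Fin (m ℕ.* n) → Carrier) → ∑ f ≈ ∑ λ i → ∑ λ j → f (combine {m} {n} i j)
  ∑-combine zero    n f = trans (∑-empty f) (sym (∑-empty _))
  ∑-combine (suc m) n f = trans (∑-split n (m ℕ.* n) f)
    (trans (+-congˡ (∑-combine m n (f ∘ (n ↑ʳ_)))) (sym (∑-suc _)))

  ∑-≈0 : {f : Fin n → Carrier} → (∀ i → f i ≈ 0#) → ∑ f ≈ 0#
  ∑-≈0 f≈0 = trans (∑-cong f≈0) ∑-0

  δ : Fin n → Fin n → Carrier
  δ zero    zero    = 1#
  δ zero    (suc j) = 0#
  δ (suc i) zero    = 0#
  δ (suc i) (suc j) = δ i j

  δ-refl : (i : Fin n) → δ i i ≈ 1#
  δ-refl zero    = refl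
  δ-refl (suc i) = δ-refl i

  δ-≢ : {i j : Fin n} → i ≢ j → δ i j ≈ 0#
  δ-≢ {i = zero}  {zero}  i≢j = contradiction ≡.refl i≢j
  δ-≢ {i = zero}  {suc j} i≢j = refl
  δ-≢ {i = suc i} {zero}  i≢j = refl
  δ-≢ {i = suc i} {suc j} i≢j = δ-≢ (i≢j ∘ ≡.cong suc)

  δ-sym : (i j : Fin n) → δ i j ≈ δ j i
  δ-sym zero    zero    = refl
  δ-sym zero    (suc j) = refl
  δ-sym (suc i) zero    = refl
  δ-sym (suc i) (suc j) = δ-sym i j

  -- Substitutions under `δ` are justified by an equivalence of the two index equations, so later
  -- reindexings need only the bijection behind them.
  δ-⇔ : ∀ {i j : Fin n} {i′ j′ : Fin m} → (i ≡ j → i′ ≡ j′) → (i′ ≡ j′ → i ≡ j) → δ i j ≈ δ i′ j′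
  δ-⇔ {i = i} {j} {i′} {j′} to from with i Fin.≟ j
  ... | yes ≡.refl rewrite to ≡.refl = trans (δ-refl i) (sym (δ-refl j′))
  ... | no i≢j = trans (δ-≢ i≢j) (sym (δ-≢ (i≢j ∘ from)))

  ∑-δˡ : ∀ i (f : Fin n → Carrier) → ∑ (λ j → δ i j * f j) ≈ f i
  ∑-δˡ zero f = trans (∑-suc _) (trans (+-cong (*-identityˡ _) (∑-≈0 λ j → zeroˡ _)) (+-identityʳ _))
  ∑-δˡ (suc i) f = trans (∑-suc _) (trans (+-cong (zeroˡ _) (∑-δˡ i (f ∘ suc))) (+-identityˡ _))

  ∑-δʳ : ∀ i (f : Fin n → Carrier) → ∑ (λ j → f j * δ j i) ≈ f i
  ∑-δʳ i f = trans (∑-cong λ j → trans (*-comm _ _) (*-congʳ (δ-sym j i))) (∑-δˡ i f)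

module Determinant {c ℓ} (R : CommutativeRing c ℓ) where
  open import Data.Vec.Functional as Vector
    using (Vector; _∷_; _++_; head; tail; removeAt; insertAt; updateAt)
  open import Data.Vec.Functional.Properties using (updateAt-updates; updateAt-minimal)
  open CommutativeRing R hiding (zero)
  open Summation R
  open import Algebra.Properties.Semiring.Exp semiring using (_^_)
  open import Algebra.Properties.Ring ring
    using (-‿distribˡ-*; -‿distribʳ-*; -‿involutive; +-identityʳ-unique; +-inverseˡ-unique)
  open import Algebra.Solver.Ring.NaturalCoefficients.Default commutativeSemiring
    using (solve; _:=_; _:+_; _:*_)
  open ≈-Reasoning setoid

  private variable
    m n k : ℕ

  Matrix : ℕ → ℕ → Set c
  Matrix n m = Fin n → Fin m → Carrier

  infix 4 _≋_
  _≋_ : Matrix n m → Matrix n m → Set ℓ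
  M ≋ N = ∀ i k → M i k ≈ N i k

  sgn : ℕ → Carrier
  sgn zero    = 1#
  sgn (suc k) = - sgn k

  minor : Matrix (suc n) (suc m) → Fin (suc m) → Matrix n m
  minor M j i = removeAt (M (suc i)) j

  opaque
    det : Matrix n n → Carrier
    det {zero}  M = 1#
    det {suc n} M = ∑ λ j → sgn (toℕ j) * (M zero j * det (minor M j))

    det-empty : (M : Matrix 0 0) → det M ≈ 1#
    det-empty M = refl

    det-suc : (M : Matrix (suc n) (suc n)) →
              det M ≈ ∑ λ j → sgn (toℕ j) * (M zero j * det (minor M j))
    det-suc M = refl

  det-cong : {M N : Matrix n n} → M ≋ N → det M ≈ det N
  det-cong {zero}  M≋N = trans (det-empty _) (sym (det-empty _))
  det-cong {suc n} M≋N = trans (det-suc _) (trans (∑-cong λ j →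
    *-congˡ (*-cong (M≋N zero j) (det-cong λ i k → M≋N (suc i) (punchIn j k)))) (sym (det-suc _)))

  -- Multilinear and alternating forms in the rows of a matrix

  AgreeOff : Fin n → Matrix n m → Matrix n m → Set ℓ
  AgreeOff i M N = ∀ j → j ≢ i → ∀ k → M j k ≈ N j k

  -- One law per row covers additivity and homogeneity. It compares three matrices that agree off
  -- that row up to `≈`, so it applies without writing any of them as an update of another.
  record IsMultilinear {n m} (f : Matrix n m → Carrier) : Set (c ⊔ ℓ) where
    field
      cong   : ∀ {M N} → M ≋ N → f M ≈ f N
      linear : ∀ i x {M M′ M″} →
               (∀ k → M i k ≈ M′ i k + x * M″ i k) →
               AgreeOff i M M′ → AgreeOff i M M″ →
               f M ≈ f M′ + x * f M″

  VanishesAt : (Matrix n m → Carrier) → Fin n → Fin n → Set (c ⊔ ℓ)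
  VanishesAt f i j = ∀ {M} → (∀ k → M i k ≈ M j k) → f M ≈ 0#

  record IsAlternating {n m} (f : Matrix n m → Carrier) : Set (c ⊔ ℓ) where
    field
      isMultilinear : IsMultilinear f
      alternating   : ∀ i j → i ≢ j → VanishesAt f i j
    open IsMultilinear isMultilinear public

  det-isMultilinear : IsMultilinear (det {n})
  det-isMultilinear {n} = record { cong = det-cong ; linear = linear }
    where
    rearrange₁ : ∀ s a b x d → s * ((a + x * b) * d) ≈ s * (a * d) + x * (s * (b * d))
    rearrange₁ = solve 5 (λ s a b x d → s :* ((a :+ x :* b) :* d) := s :* (a :* d) :+ x :* (s :* (b :* d))) refl

    rearrange₂ : ∀ s a x d e → s * (a * (d + x * e)) ≈ s * (a * d) + x * (s * (a * e))
    rearrange₂ = solve 5 (λ s a x d e → s :* (a :* (d :+ x :* e)) := s :* (a :* d) :+ x :* (s :* (a :* e))) refl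

    expand : ∀ {n} x {M M′ M″ : Matrix (suc n) (suc n)} →
             let term : Matrix (suc n) (suc n) → Fin (suc n) → Carrier
                 term M j = sgn (toℕ j) * (M zero j * det (minor M j)) in
             (∀ j → term M j ≈ term M′ j + x * term M″ j) →
             det M ≈ det M′ + x * det M″
    expand x {M} {M′} {M″} t≈ = begin
      det M                            ≈⟨ trans (det-suc M) (∑-cong t≈) ⟩
      _                                ≈⟨ ∑-+ _ _ ⟩
      _                                ≈⟨ +-congˡ (*-∑ x _) ⟨
      _                                ≈⟨ +-cong (det-suc M′) (*-congˡ (det-suc M″)) ⟨
      det M′ + x * det M″              ∎

    linear : ∀ i x {M M′ M″} → (∀ k → M i k ≈ M′ i k + x * M″ i k) →
             AgreeOff i M M′ → AgreeOff i M M″ → det M ≈ det M′ + x * det M″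
    linear zero x {M} {M′} {M″} row off′ off″ = expand x λ j → begin
      sgn (toℕ j) * (M zero j * det (minor M j))
        ≈⟨ *-congˡ (*-congʳ (row j)) ⟩
      sgn (toℕ j) * ((M′ zero j + x * M″ zero j) * det (minor M j))
        ≈⟨ rearrange₁ _ _ _ _ _ ⟩
      sgn (toℕ j) * (M′ zero j * det (minor M j)) + x * (sgn (toℕ j) * (M″ zero j * det (minor M j)))
        ≈⟨ +-cong (*-congˡ (*-congˡ (det-cong λ i k → off′ (suc i) (λ ()) _)))
                  (*-congˡ (*-congˡ (*-congˡ (det-cong λ i k → off″ (suc i) (λ ()) _)))) ⟩
      sgn (toℕ j) * (M′ zero j * det (minor M′ j)) + x * (sgn (toℕ j) * (M″ zero j * det (minor M″ j))) ∎
    linear (suc i) x {M} {M′} {M″} row off′ off″ = expand x λ j → begin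
      sgn (toℕ j) * (M zero j * det (minor M j))
        ≈⟨ *-congˡ (*-congˡ (IsMultilinear.linear det-isMultilinear i x
             (λ k → row (punchIn j k))
             (λ i′ i′≢i k → off′ (suc i′) (i′≢i ∘ Fin.suc-injective) _)
             (λ i′ i′≢i k → off″ (suc i′) (i′≢i ∘ Fin.suc-injective) _))) ⟩
      sgn (toℕ j) * (M zero j * (det (minor M′ j) + x * det (minor M″ j)))
        ≈⟨ rearrange₂ _ _ _ _ _ ⟩
      sgn (toℕ j) * (M zero j * det (minor M′ j)) + x * (sgn (toℕ j) * (M zero j * det (minor M″ j)))
        ≈⟨ +-cong (*-congˡ (*-congʳ (off′ zero (λ ()) j)))
                  (*-congˡ (*-congˡ (*-congʳ (off″ zero (λ ()) j)))) ⟩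
      sgn (toℕ j) * (M′ zero j * det (minor M′ j)) + x * (sgn (toℕ j) * (M″ zero j * det (minor M″ j))) ∎

  infixl 6 _[_]≔_
  _[_]≔_ : Matrix n m → Fin n → (Fin m → Carrier) → Matrix n m
  M [ i ]≔ r = updateAt M i (const r)

  ≔-same : ∀ (M : Matrix n m) i r k → (M [ i ]≔ r) i k ≈ r k
  ≔-same M i r k = reflexive (≡.cong (λ row → row k) (updateAt-updates i M))

  ≔-other : ∀ (M : Matrix n m) i r → AgreeOff i (M [ i ]≔ r) M
  ≔-other M i r j j≢i k = reflexive (≡.cong (λ row → row k) (updateAt-minimal j i M j≢i))

  ≔-agree : ∀ (M : Matrix n m) i r s → AgreeOff i (M [ i ]≔ r) (M [ i ]≔ s)
  ≔-agree M i r s j j≢i k = trans (≔-other M i r j j≢i k) (sym (≔-other M i s j j≢i k))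

  vanishesAt-sym : ∀ {f : Matrix n m → Carrier} {i j} → VanishesAt f i j → VanishesAt f j i
  vanishesAt-sym fij eq = fij (sym ∘ eq)

  -- Adding row `b` to row `c`, and then row `a` to row `b`, does not change the value: the extra
  -- terms have equal rows `b`, `c` and equal rows `a`, `b`, respectively. As rows `a` and `c`
  -- agree, rows `b` and `c` have then both become `u`, so the value is 0.
  vanishesAt-trans : ∀ {f : Matrix n m → Carrier} → IsMultilinear f → ∀ {a b c} →
                     a ≢ b → b ≢ c → a ≢ c →
                     VanishesAt f a b → VanishesAt f b c → VanishesAt f a c
  vanishesAt-trans {n} {m} {f} isMultilinear {a} {b} {c} a≢b b≢c a≢c fab fbc {M} Ma≈Mc = begin
    f M                        ≈⟨ *-identityˡ _ ⟨
    1# * f M                   ≈⟨ +-identityˡ _ ⟨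
    0# + 1# * f M              ≈⟨ +-congʳ (fbc λ k → trans (≔-other M c w b b≢c k) (sym (≔-same M c w k))) ⟨
    f (M [ c ]≔ w) + 1# * f M  ≈⟨ linear c 1# {Y} {M [ c ]≔ w} {M}
                                    (λ k → begin
                                      Y c k                            ≈⟨ ≔-same M c u k ⟩
                                      w k + M a k                      ≈⟨ +-cong (sym (≔-same M c w k))
                                                                                (trans (Ma≈Mc k) (sym (*-identityˡ _))) ⟩
                                      (M [ c ]≔ w) c k + 1# * M c k    ∎)
                                    (≔-agree M c u w) (≔-other M c u) ⟨
    f Y                        ≈⟨ +-identityʳ _ ⟨
    f Y + 0#                   ≈⟨ +-congˡ (zeroʳ 1#) ⟨
    f Y + 1# * 0#              ≈⟨ +-congˡ (*-congˡ (fab λ k → begin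
                                    (Y [ b ]≔ M a) a k  ≈⟨ ≔-other Y b (M a) a a≢b k ⟩
                                    Y a k               ≈⟨ ≔-other M c u a a≢c k ⟩
                                    M a k               ≈⟨ ≔-same Y b (M a) k ⟨
                                    (Y [ b ]≔ M a) b k  ∎)) ⟨
    f Y + 1# * f (Y [ b ]≔ M a) ≈⟨ linear b 1# {Y [ b ]≔ u} {Y} {Y [ b ]≔ M a}
                                    (λ k → begin
                                      (Y [ b ]≔ u) b k                 ≈⟨ ≔-same Y b u k ⟩
                                      w k + M a k                      ≈⟨ +-cong (sym (≔-other M c u b b≢c k))
                                                                                (sym (trans (*-identityˡ _) (≔-same Y b (M a) k))) ⟩
                                      Y b k + 1# * (Y [ b ]≔ M a) b k  ∎)
                                    (≔-other Y b u) (≔-agree Y b u (M a)) ⟨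
    f (Y [ b ]≔ u)             ≈⟨ fbc (λ k → begin
                                    (Y [ b ]≔ u) b k  ≈⟨ ≔-same Y b u k ⟩
                                    u k               ≈⟨ ≔-same M c u k ⟨
                                    Y c k             ≈⟨ ≔-other Y b u c (b≢c ∘ ≡.sym) k ⟨
                                    (Y [ b ]≔ u) c k  ∎) ⟩
    0# ∎
    where
    open IsMultilinear isMultilinear
    w u : Fin m → Carrier
    w = M b
    u k = w k + M a k
    Y = M [ c ]≔ u

  -- The two ways j , punchIn j k and punchIn j k , j of removing the same pair of
  -- columns one after the other.
  data Swap : ∀ {n} → Fin (suc n) → Fin n → Fin (suc n) → Fin n → Set where
    here  : ∀ {n} {k : Fin (suc n)} → Swap zero k (suc k) zero
    there : ∀ {n} {j : Fin (suc n)} {k j′ k′} → Swap j k j′ k′ → Swap (suc j) (suc k) (suc j′) (suc k′)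

  swap-sgn : ∀ {j : Fin (suc n)} {k j′ k′} → Swap j k j′ k′ →
             sgn (toℕ j) * sgn (toℕ k) ≈ - (sgn (toℕ j′) * sgn (toℕ k′))
  swap-sgn (here {k = k}) = begin
    1# * sgn (toℕ k)         ≈⟨ *-identityˡ _ ⟩
    sgn (toℕ k)              ≈⟨ -‿involutive _ ⟨
    - - sgn (toℕ k)          ≈⟨ -‿cong (*-identityʳ _) ⟨
    - (- sgn (toℕ k) * 1#)   ∎
  swap-sgn (there s) = trans (neg-neg _ _) (trans (swap-sgn s) (-‿cong (sym (neg-neg _ _))))
    where
    neg-neg : ∀ x y → - x * - y ≈ x * y
    neg-neg x y = begin
      - x * - y      ≈⟨ -‿distribˡ-* x (- y) ⟨
      - (x * - y)    ≈⟨ -‿cong (-‿distribʳ-* x y) ⟨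
      - - (x * y)    ≈⟨ -‿involutive _ ⟩
      x * y          ∎

  swap-punchInˡ : ∀ {j : Fin (suc n)} {k j′ k′} → Swap j k j′ k′ → punchIn j k ≡ j′
  swap-punchInˡ here      = ≡.refl
  swap-punchInˡ (there s) = ≡.cong suc (swap-punchInˡ s)

  swap-punchInʳ : ∀ {j : Fin (suc n)} {k j′ k′} → Swap j k j′ k′ → punchIn j′ k′ ≡ j
  swap-punchInʳ here      = ≡.refl
  swap-punchInʳ (there s) = ≡.cong suc (swap-punchInʳ s)

  swap-punchIn² : ∀ {j : Fin (suc (suc n))} {k j′ k′} → Swap j k j′ k′ →
                  ∀ x → punchIn j (punchIn k x) ≡ punchIn j′ (punchIn k′ x)
  swap-punchIn² here      x       = ≡.refl
  swap-punchIn² (there s) zero    = ≡.refl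
  swap-punchIn² (there s) (suc x) = ≡.cong suc (swap-punchIn² s x)

  -- The terms (0 , k) and (k + 1 , 0) cancel, and the remaining terms form a sum of the same kind
  -- with one column less.
  ∑-swap : (g : Fin (suc n) → Fin n → Carrier) →
             (∀ {j k j′ k′} → Swap j k j′ k′ → g j k + g j′ k′ ≈ 0#) →
             ∑ (λ j → ∑ (g j)) ≈ 0#
  ∑-swap {zero}  g anti = ∑-≈0 λ j → ∑-empty _
  ∑-swap {suc n} g anti = begin
    ∑ (λ j → ∑ (g j))
      ≈⟨ trans (∑-suc _) (+-congˡ (∑-cong λ j → ∑-suc _)) ⟩
    ∑ (g zero) + ∑ (λ j → g (suc j) zero + ∑ (λ k → g (suc j) (suc k)))
      ≈⟨ +-congˡ (∑-+ (λ j → g (suc j) zero) _) ⟩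
    ∑ (g zero) + (∑ (λ j → g (suc j) zero) + ∑ (λ j → ∑ λ k → g (suc j) (suc k)))
      ≈⟨ +-congˡ (+-congˡ (∑-swap (λ j k → g (suc j) (suc k)) (anti ∘ there))) ⟩
    ∑ (g zero) + (∑ (λ j → g (suc j) zero) + 0#)
      ≈⟨ +-congˡ (+-identityʳ _) ⟩
    ∑ (g zero) + ∑ (λ j → g (suc j) zero)
      ≈⟨ ∑-+ (g zero) _ ⟨
    ∑ (λ k → g zero k + g (suc k) zero)
      ≈⟨ ∑-≈0 (λ k → anti here) ⟩
    0# ∎

  -- After expansion along two rows, exchanging the two removed columns keeps the minor and, as the
  -- rows are equal, the product of entries, but reverses the sign.
  det-vanishes-01 : VanishesAt (det {suc (suc n)}) zero (suc zero)
  det-vanishes-01 {n} {M} M₀≈M₁ = trans (det-suc M) (trans (∑-cong expand) (∑-swap g anti))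
    where
    minor² : Fin (suc (suc n)) → Fin (suc n) → Matrix n n
    minor² j k = minor (minor M j) k

    g : Fin (suc (suc n)) → Fin (suc n) → Carrier
    g j k = (sgn (toℕ j) * sgn (toℕ k)) * ((M zero j * M zero (punchIn j k)) * det (minor² j k))

    expand : ∀ j → sgn (toℕ j) * (M zero j * det (minor M j)) ≈ ∑ (g j)
    expand j = begin
      sgn (toℕ j) * (M zero j * det (minor M j))
        ≈⟨ *-assoc _ _ _ ⟨
      sgn (toℕ j) * M zero j * det (minor M j)
        ≈⟨ *-congˡ (det-suc (minor M j)) ⟩
      sgn (toℕ j) * M zero j * _
        ≈⟨ *-∑ (sgn (toℕ j) * M zero j) (λ k → sgn (toℕ k) * (M (suc zero) (punchIn j k) * det (minor² j k))) ⟩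
      ∑ (λ k → sgn (toℕ j) * M zero j * (sgn (toℕ k) * (M (suc zero) (punchIn j k) * det (minor² j k))))
        ≈⟨ ∑-cong (λ k → trans (*-congˡ (*-congˡ (*-congʳ (sym (M₀≈M₁ _)))))
             (solve 5 (λ s t x y d → (s :* x) :* (t :* (y :* d)) := (s :* t) :* ((x :* y) :* d)) refl
               (sgn (toℕ j)) (sgn (toℕ k)) _ _ _)) ⟩
      ∑ (g j) ∎

    anti : ∀ {j k j′ k′} → Swap j k j′ k′ → g j k + g j′ k′ ≈ 0#
    anti {j} {k} {j′} {k′} s = begin
      g j k + g j′ k′
        ≈⟨ +-congʳ (*-cong (swap-sgn s) (*-cong
             (trans (*-comm _ _) (*-cong (reflexive (≡.cong (M zero) (swap-punchInˡ s)))
                                         (reflexive (≡.cong (M zero) (≡.sym (swap-punchInʳ s))))))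
             (det-cong λ i x → reflexive (≡.cong (M (suc (suc i))) (swap-punchIn² s x))))) ⟩
      - (sgn (toℕ j′) * sgn (toℕ k′)) * _ + g j′ k′
        ≈⟨ +-congʳ (-‿distribˡ-* _ _) ⟨
      - g j′ k′ + g j′ k′
        ≈⟨ -‿inverseˡ _ ⟩
      0# ∎

  det-vanishes-suc : ∀ {i j : Fin n} → VanishesAt det i j → VanishesAt det (suc i) (suc j)
  det-vanishes-suc {i = i} {j} van {M} Mᵢ≈Mⱼ = trans (det-suc M) (∑-≈0 λ l → trans (*-congˡ (trans
    (*-congˡ (van {minor M l} λ k → Mᵢ≈Mⱼ (punchIn l k))) (zeroʳ (M zero l))))
    (zeroʳ (sgn (toℕ l))))

  det-alternating : ∀ (i j : Fin n) → i ≢ j → VanishesAt det i j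
  -- Row 0 reaches a row further down through row 1: rows 0 and 1 are settled directly, and rows 1
  -- and `suc (suc j)` lie below the first row, where the claim for `j` applies to the minors.
  det-vanishes-0 : ∀ (j : Fin n) → VanishesAt (det {suc n}) zero (suc j)

  det-alternating zero    zero    i≢j {M} = contradiction ≡.refl i≢j
  det-alternating zero    (suc j) i≢j {M} = det-vanishes-0 j {M}
  det-alternating (suc i) zero    i≢j {M} = vanishesAt-sym {f = det} (λ {M} → det-vanishes-0 i {M}) {M}
  det-alternating (suc i) (suc j) i≢j {M} =
    det-vanishes-suc (λ {M} → det-alternating i j (i≢j ∘ ≡.cong suc) {M}) {M}

  det-vanishes-0 zero {M} = det-vanishes-01 {M = M}
  det-vanishes-0 (suc j) {M} =
    vanishesAt-trans {f = det} det-isMultilinear {b = suc zero} (λ ()) (λ ()) (λ ())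
      (λ {M} → det-vanishes-01 {M = M})
      (det-vanishes-suc λ {M} → det-vanishes-0 j {M}) {M}

  det-isAlternating : IsAlternating (det {n})
  det-isAlternating = record { isMultilinear = det-isMultilinear ; alternating = det-alternating }

  double-zero : ∀ {x} → x ≈ x + 1# * x → x ≈ 0#
  double-zero {x} eq = +-identityʳ-unique x x (trans (+-congˡ (sym (*-identityˡ x))) (sym eq))

  record IsLinear {m k} (L : (Fin m → Carrier) → (Fin k → Carrier)) : Set (c ⊔ ℓ) where
    field
      cong   : ∀ {u v} → (∀ j → u j ≈ v j) → ∀ j → L u j ≈ L v j
      linear : ∀ x {u v w} → (∀ j → u j ≈ v j + x * w j) → ∀ j → L u j ≈ L v j + x * L w j

  map-rows : ∀ {f : Matrix n k → Carrier} {L} → IsLinear {m} {k} L →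
             IsAlternating f → IsAlternating λ M → f (λ i → L (M i))
  map-rows L-linear f-alt = record
    { isMultilinear = record
      { cong   = λ M≋N → f.cong λ i → L.cong (M≋N i)
      ; linear = λ i x row off′ off″ → f.linear i x (L.linear x row)
          (λ j j≢i → L.cong (off′ j j≢i)) (λ j j≢i → L.cong (off″ j j≢i))
      }
    ; alternating = λ i j i≢j eq → f.alternating i j i≢j (L.cong eq)
    }
    where
    module f = IsAlternating f-alt
    module L = IsLinear L-linear

  ∷-cong : ∀ {u v : Fin m → Carrier} {M N : Matrix n m} →
           (∀ k → u k ≈ v k) → M ≋ N → u ∷ M ≋ v ∷ N
  ∷-cong u≈v M≋N zero    = u≈v
  ∷-cong u≈v M≋N (suc i) = M≋N i

  fix-row : ∀ {f : Matrix (suc n) m → Carrier} → IsAlternating f →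
            ∀ v → IsAlternating λ M → f (v ∷ M)
  fix-row f-alt v = record
    { isMultilinear = record
      { cong   = λ M≋N → f.cong (∷-cong (λ _ → refl) M≋N)
      ; linear = λ i x row off′ off″ → f.linear (suc i) x row (agree off′) (agree off″)
      }
    ; alternating = λ i j i≢j eq → f.alternating (suc i) (suc j) (i≢j ∘ Fin.suc-injective) eq
    }
    where
    module f = IsAlternating f-alt
    agree : ∀ {i M N} → AgreeOff i M N → AgreeOff (suc i) (v ∷ M) (v ∷ N)
    agree off zero    _   k = refl
    agree off (suc j) j≢i k = off j (j≢i ∘ ≡.cong suc) k

  module _ {f : Matrix (suc n) m → Carrier} (f-alt : IsAlternating f) where
    open IsAlternating f-alt

    head-linear : ∀ x {u v w : Fin m → Carrier} {M} → (∀ k → u k ≈ v k + x * w k) →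
                  f (u ∷ M) ≈ f (v ∷ M) + x * f (w ∷ M)
    head-linear x eq = linear zero x eq
      (λ { zero 0≢0 → contradiction ≡.refl 0≢0 ; (suc i) _ k → refl })
      (λ { zero 0≢0 → contradiction ≡.refl 0≢0 ; (suc i) _ k → refl })

  linear-expansion : ∀ {φ : (Fin m → Carrier) → Carrier} →
    (∀ {u v} → (∀ k → u k ≈ v k) → φ u ≈ φ v) →
    (∀ x {u v w} → (∀ k → u k ≈ v k + x * w k) → φ u ≈ φ v + x * φ w) →
    ∀ r → φ r ≈ ∑ λ j → r j * φ (δ j)
  -- Without columns all vectors coincide, and linearity itself says that the value is twice itself.
  linear-expansion {zero} {φ} cong linear r =
    trans (double-zero (linear 1# λ ())) (sym (∑-empty _))
  linear-expansion {suc m} {φ} cong linear r = begin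
    φ r
      ≈⟨ linear (r zero) {r} {0# ∷ tail r} {δ zero} (λ
           { zero    → sym (trans (+-identityˡ _) (*-identityʳ _))
           ; (suc k) → sym (trans (+-congˡ (zeroʳ _)) (+-identityʳ _)) }) ⟩
    φ (0# ∷ tail r) + r zero * φ (δ zero)
      ≈⟨ +-comm _ _ ⟩
    r zero * φ (δ zero) + φ (0# ∷ tail r)
      ≈⟨ +-congˡ (linear-expansion {φ = λ u → φ (0# ∷ u)}
           (λ eq → cong λ { zero → refl ; (suc k) → eq k })
           (λ x eq → linear x λ
             { zero    → sym (trans (+-identityˡ _) (zeroʳ x))
             ; (suc k) → eq k })
           (tail r)) ⟩
    r zero * φ (δ zero) + ∑ (λ j → r (suc j) * φ (0# ∷ δ j))
      ≈⟨ +-congˡ (∑-cong λ j → *-congˡ (cong λ { zero → refl ; (suc k) → refl })) ⟩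
    r zero * φ (δ zero) + ∑ (λ j → r (suc j) * φ (δ (suc j)))
      ≈⟨ ∑-suc _ ⟨
    ∑ (λ j → r j * φ (δ j)) ∎

  swap-rows : ∀ {f : Matrix (suc (suc n)) m → Carrier} → IsAlternating f →
              ∀ u v M → f (u ∷ v ∷ M) ≈ - f (v ∷ u ∷ M)
  swap-rows {n} {m} {f} f-alt u v M = +-inverseˡ-unique _ _ (begin
    f (u ∷ v ∷ M) + f (v ∷ u ∷ M)
      ≈⟨ +-cong head-part head-part′ ⟨
    f (u ∷ w ∷ M) + f (v ∷ w ∷ M)
      ≈⟨ +-congˡ (*-identityˡ _) ⟨
    f (u ∷ w ∷ M) + 1# * f (v ∷ w ∷ M)
      ≈⟨ head-linear f-alt 1# w≈ ⟨
    f (w ∷ w ∷ M)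
      ≈⟨ alternating zero (suc zero) (λ ()) (λ _ → refl) ⟩
    0# ∎)
    where
    open IsAlternating f-alt
    w : Fin m → Carrier
    w k = u k + v k
    w≈ : ∀ k → w k ≈ u k + 1# * v k
    w≈ k = +-congˡ (sym (*-identityˡ _))
    expand : ∀ r → f (r ∷ w ∷ M) ≈ f (r ∷ u ∷ M) + f (r ∷ v ∷ M)
    expand r = trans (head-linear (fix-row f-alt r) 1# w≈) (+-congˡ (*-identityˡ _))
    head-part : f (u ∷ w ∷ M) ≈ f (u ∷ v ∷ M)
    head-part = trans (expand u) (trans (+-congʳ (alternating zero (suc zero) (λ ()) (λ _ → refl))) (+-identityˡ _))
    head-part′ : f (v ∷ w ∷ M) ≈ f (v ∷ u ∷ M)
    head-part′ = trans (expand v) (trans (+-congˡ (alternating zero (suc zero) (λ ()) (λ _ → refl))) (+-identityʳ _))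

  -- One row is cleared by linearity. It then changes places with `v`, so that the induction can run
  -- on the form with the cleared row fixed; changing back undoes the sign.
  add-multiples-of-head : ∀ {f : Matrix (suc n) m → Carrier} → IsAlternating f →
    ∀ v (c : Fin n → Carrier) {M N : Matrix n m} →
    (∀ i k → N i k ≈ M i k + c i * v k) → f (v ∷ N) ≈ f (v ∷ M)
  add-multiples-of-head {zero} f-alt v c eq =
    IsAlternating.cong f-alt (∷-cong (λ _ → refl) (λ ()))
  add-multiples-of-head {suc n} {m} {f} f-alt v c {M} {N} eq = begin
    f (v ∷ N)
      ≈⟨ cong (∷-cong (λ _ → refl) λ { zero k → refl ; (suc i) k → refl }) ⟩
    f (v ∷ head N ∷ tail N)
      ≈⟨ head-linear (fix-row f-alt v) (c zero) (eq zero) ⟩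
    f (v ∷ head M ∷ tail N) + c zero * f (v ∷ v ∷ tail N)
      ≈⟨ +-congˡ (*-congˡ (alternating zero (suc zero) (λ ()) (λ _ → refl))) ⟩
    f (v ∷ head M ∷ tail N) + c zero * 0#
      ≈⟨ trans (+-congˡ (zeroʳ _)) (+-identityʳ _) ⟩
    f (v ∷ head M ∷ tail N)
      ≈⟨ swap-rows f-alt _ _ _ ⟩
    - f (head M ∷ v ∷ tail N)
      ≈⟨ -‿cong (add-multiples-of-head (fix-row f-alt (head M)) v (c ∘ suc) (eq ∘ suc)) ⟩
    - f (head M ∷ v ∷ tail M)
      ≈⟨ swap-rows f-alt _ _ _ ⟨
    f (v ∷ head M ∷ tail M)
      ≈⟨ cong (∷-cong (λ _ → refl) λ { zero k → refl ; (suc i) k → refl }) ⟩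
    f (v ∷ M) ∎
    where open IsAlternating f-alt

  move-to-head : ∀ {f : Matrix (suc n) m → Carrier} → IsAlternating f →
                 ∀ j M → f (M j ∷ removeAt M j) ≈ sgn (toℕ j) * f M
  move-to-head f-alt zero M = trans
    (IsAlternating.cong f-alt λ { zero k → refl ; (suc i) k → refl }) (sym (*-identityˡ _))
  move-to-head {suc n} {f = f} f-alt (suc j) M = begin
    f (M (suc j) ∷ removeAt M (suc j))
      ≈⟨ cong (∷-cong (λ _ → refl) λ { zero k → refl ; (suc i) k → refl }) ⟩
    f (M (suc j) ∷ head M ∷ removeAt (tail M) j)
      ≈⟨ swap-rows f-alt _ _ _ ⟩
    - f (head M ∷ M (suc j) ∷ removeAt (tail M) j)
      ≈⟨ -‿cong (move-to-head (fix-row f-alt (head M)) j (tail M)) ⟩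
    - (sgn (toℕ j) * f (head M ∷ tail M))
      ≈⟨ -‿distribˡ-* _ _ ⟩
    - sgn (toℕ j) * f (head M ∷ tail M)
      ≈⟨ *-congˡ (cong λ { zero k → refl ; (suc i) k → refl }) ⟩
    - sgn (toℕ j) * f M ∎
    where open IsAlternating f-alt

  -- The rows of a minor re-enter the full matrix with 0 in the deleted column; linearity of this
  -- insertion makes the outcome an alternating form of the minor.
  insertAt-isLinear : ∀ (j : Fin (suc m)) → IsLinear λ u → insertAt u j 0#
  insertAt-isLinear j = record { cong = cong j ; linear = λ x → linear j x }
    where
    cong : ∀ {m} (j : Fin (suc m)) {u v : Fin m → Carrier} → (∀ k → u k ≈ v k) →
           ∀ k → insertAt u j 0# k ≈ insertAt v j 0# k
    cong zero                eq zero    = refl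
    cong zero                eq (suc k) = eq k
    cong {suc m} (suc j)     eq zero    = eq zero
    cong {suc m} (suc j)     eq (suc k) = cong j (eq ∘ suc) k

    linear : ∀ {m} (j : Fin (suc m)) x {u v w : Fin m → Carrier} →
             (∀ k → u k ≈ v k + x * w k) →
             ∀ k → insertAt u j 0# k ≈ insertAt v j 0# k + x * insertAt w j 0# k
    linear zero            x eq zero    = sym (trans (+-identityˡ _) (zeroʳ x))
    linear zero            x eq (suc k) = eq k
    linear {suc m} (suc j) x eq zero    = eq zero
    linear {suc m} (suc j) x eq (suc k) = linear j x (eq ∘ suc) k

  insertAt-removeAt : ∀ (r : Fin (suc m) → Carrier) j k →
                      insertAt (removeAt r j) j 0# k ≈ r k + - r j * δ j k
  insertAt-removeAt r zero zero = sym (trans (+-congˡ (*-identityʳ _)) (-‿inverseʳ _))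
  insertAt-removeAt r zero (suc k) = sym (trans (+-congˡ (zeroʳ _)) (+-identityʳ _))
  insertAt-removeAt {suc m} r (suc j) zero = sym (trans (+-congˡ (zeroʳ _)) (+-identityʳ _))
  insertAt-removeAt {suc m} r (suc j) (suc k) = insertAt-removeAt (tail r) j k

  insertAt-δ : ∀ (j : Fin (suc m)) i k → insertAt (δ i) j 0# k ≈ δ (punchIn j i) k
  insertAt-δ zero    i       zero    = refl
  insertAt-δ zero    i       (suc k) = refl
  insertAt-δ (suc j) zero    zero    = refl
  insertAt-δ (suc j) (suc i) zero    = refl
  insertAt-δ {suc m} (suc j) zero    (suc k) = insertAt-0 j k
    where
    insertAt-0 : ∀ {m} (j : Fin (suc m)) k → insertAt {n = m} (λ _ → 0#) j 0# k ≈ 0#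
    insertAt-0 zero            zero    = refl
    insertAt-0 zero            (suc k) = refl
    insertAt-0 {suc m} (suc j) zero    = refl
    insertAt-0 {suc m} (suc j) (suc k) = insertAt-0 j k
  insertAt-δ {suc m} (suc j) (suc i) (suc k) = insertAt-δ j i k

  -- Expanding f along the head row r, the rows below may be cleared in column j by
  -- subtracting multiples of δ j, which leaves an alternating form of the minor.
  det-unique : ∀ {f : Matrix n n → Carrier} → IsAlternating f → ∀ M → f M ≈ det M * f δ
  det-unique {zero} f-alt M = trans (IsAlternating.cong f-alt λ ())
    (sym (trans (*-congʳ (det-empty M)) (*-identityˡ _)))
  det-unique {suc n} {f} f-alt M = begin
    f M
      ≈⟨ cong (λ { zero k → refl ; (suc i) k → refl }) ⟩
    f (head M ∷ tail M)
      ≈⟨ linear-expansion {φ = λ r → f (r ∷ tail M)}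
           (λ eq → cong (∷-cong eq λ _ _ → refl)) (λ x eq → head-linear f-alt x eq) (head M) ⟩
    ∑ (λ j → M zero j * f (δ j ∷ tail M))
      ≈⟨ ∑-cong (λ j → *-congˡ (add-multiples-of-head f-alt (δ j) (λ i → - M (suc i) j)
           λ i → insertAt-removeAt (M (suc i)) j)) ⟨
    ∑ (λ j → M zero j * f (δ j ∷ λ i → insertAt (minor M j i) j 0#))
      ≈⟨ ∑-cong (λ j → *-congˡ (det-unique
           (map-rows (insertAt-isLinear j) (fix-row f-alt (δ j))) (minor M j))) ⟩
    ∑ (λ j → M zero j * (det (minor M j) * f (δ j ∷ λ i → insertAt (δ i) j 0#)))
      ≈⟨ ∑-cong (λ j → *-congˡ (*-congˡ (trans
           (cong (∷-cong (λ _ → refl) (insertAt-δ j))) (move-to-head f-alt j δ)))) ⟩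
    ∑ (λ j → M zero j * (det (minor M j) * (sgn (toℕ j) * f δ)))
      ≈⟨ ∑-cong (λ j → solve 4 (λ a d s x → a :* (d :* (s :* x)) := (s :* (a :* d)) :* x) refl
           (M zero j) (det (minor M j)) (sgn (toℕ j)) (f δ)) ⟩
    ∑ (λ j → sgn (toℕ j) * (M zero j * det (minor M j)) * f δ)
      ≈⟨ ∑-* (f δ) _ ⟨
    ∑ (λ j → sgn (toℕ j) * (M zero j * det (minor M j))) * f δ
      ≈⟨ *-congʳ (det-suc M) ⟨
    det M * f δ ∎
    where open IsAlternating f-alt

  -- Matrix products, conjugation and permutation

  infixl 7 _⊗_
  _⊗_ : Matrix n m → Matrix m k → Matrix n k
  (A ⊗ B) i k = ∑ λ j → A i j * B j k

  ⊗-row-isLinear : (B : Matrix m k) → IsLinear λ u l → ∑ λ j → u j * B j l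
  ⊗-row-isLinear B = record
    { cong   = λ eq l → ∑-cong λ j → *-congʳ (eq j)
    ; linear = λ x {u} {v} {w} eq l → begin
        ∑ (λ j → u j * B j l)
          ≈⟨ ∑-cong (λ j → trans (*-congʳ (eq j)) (solve 4 (λ v x w b →
               (v :+ x :* w) :* b := v :* b :+ x :* (w :* b)) refl (v j) x (w j) (B j l))) ⟩
        ∑ (λ j → v j * B j l + x * (w j * B j l))
          ≈⟨ ∑-+ _ _ ⟩
        ∑ (λ j → v j * B j l) + ∑ (λ j → x * (w j * B j l))
          ≈⟨ +-congˡ (*-∑ x _) ⟨
        ∑ (λ j → v j * B j l) + x * ∑ (λ j → w j * B j l) ∎
    }

  -- For fixed `B`, the determinant of `A ⊗ B` is an alternating form of the rows of `A` whose value
  -- at the identity is `det B`.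
  det-⊗ : (A B : Matrix n n) → det (A ⊗ B) ≈ det A * det B
  det-⊗ A B = begin
    det (A ⊗ B)           ≈⟨ det-unique (map-rows (⊗-row-isLinear B) det-isAlternating) A ⟩
    det A * det (δ ⊗ B)   ≈⟨ *-congˡ (det-cong λ i k → ∑-δˡ i (λ j → B j k)) ⟩
    det A * det B         ∎

  det-scalar : ∀ n c → det {n} (λ i j → c * δ i j) ≈ c ^ n
  det-scalar zero    c = det-empty _
  det-scalar (suc n) c = begin
    det {suc n} (λ i j → c * δ i j)
      ≈⟨ trans (det-suc _) (∑-suc _) ⟩
    1# * (c * 1# * det {n} (λ i j → c * δ i j)) + ∑ _
      ≈⟨ +-cong (trans (*-identityˡ _) (*-cong (*-identityʳ c) (det-scalar n c)))
                (∑-≈0 λ j → trans (*-congˡ (trans (*-congʳ (zeroʳ c)) (zeroˡ _))) (zeroʳ _)) ⟩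
    c * c ^ n + 0#
      ≈⟨ +-identityʳ _ ⟩
    c ^ suc n ∎

  1^n≈1 : ∀ n → 1# ^ n ≈ 1#
  1^n≈1 zero    = refl
  1^n≈1 (suc n) = trans (*-identityˡ _) (1^n≈1 n)

  -- Conjugation by a `T` that is invertible only up to the scalar `c`. The power of `c` is
  -- `det S * det T`; it stays on both sides, as `c` need not be cancellable in a general ring.
  det-intertwine : (S T M N : Matrix n n) → ∀ {c} → S ⊗ T ≋ (λ i j → c * δ i j) →
                   T ⊗ M ≋ N ⊗ T → c ^ n * det M ≈ c ^ n * det N
  det-intertwine {n} S T M N {c} ST≋c TM≋NT = begin
    c ^ n * det M                ≈⟨ *-congʳ det-ST ⟩
    det S * det T * det M        ≈⟨ *-assoc _ _ _ ⟩
    det S * (det T * det M)      ≈⟨ *-congˡ (det-⊗ T M) ⟨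
    det S * det (T ⊗ M)          ≈⟨ *-congˡ (det-cong TM≋NT) ⟩
    det S * det (N ⊗ T)          ≈⟨ *-congˡ (trans (det-⊗ N T) (*-comm _ _)) ⟩
    det S * (det T * det N)      ≈⟨ *-assoc _ _ _ ⟨
    det S * det T * det N        ≈⟨ *-congʳ det-ST ⟨
    c ^ n * det N                ∎
    where
    det-ST : c ^ n ≈ det S * det T
    det-ST = trans (sym (trans (det-cong ST≋c) (det-scalar n c))) (det-⊗ S T)

  -- Relabelling rows and columns together is conjugation by the permutation matrix `T` with inverse
  -- `S`, the case c = 1. The bijection forces both sizes to be equal.
  det-permute : ∀ (M : Matrix n n) (π : Permutation m n) →
                det (λ i j → M (π ⟨$⟩ʳ i) (π ⟨$⟩ʳ j)) ≈ det M
  det-permute {n} {m} M π with Perm.↔⇒≡ π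
  ... | ≡.refl = begin
    det N            ≈⟨ 1^n* ⟨
    1# ^ n * det N   ≈⟨ det-intertwine S T M N ST≋1 TM≋NT ⟨
    1# ^ n * det M   ≈⟨ 1^n* ⟩
    det M            ∎
    where
    1^n* : ∀ {x} → 1# ^ n * x ≈ x
    1^n* = trans (*-congʳ (1^n≈1 n)) (*-identityˡ _)
    N S T : Matrix n n
    N i j = M (π ⟨$⟩ʳ i) (π ⟨$⟩ʳ j)
    S j i = δ j (π ⟨$⟩ʳ i)
    T i j = δ (π ⟨$⟩ʳ i) j
    ST≋1 : S ⊗ T ≋ λ i j → 1# * δ i j
    ST≋1 i j = trans (sym (∑-permute (λ l → δ i l * δ l j) π))
                     (trans (∑-δˡ i (λ l → δ l j)) (sym (*-identityˡ _)))
    TM≋NT : T ⊗ M ≋ N ⊗ T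
    TM≋NT i j = trans (∑-δˡ (π ⟨$⟩ʳ i) (λ l → M l j))
      (trans (sym (∑-δʳ j (M (π ⟨$⟩ʳ i)))) (∑-permute (λ l → M (π ⟨$⟩ʳ i) l * δ l j) π))

  -- Block matrices

  onPairs : (Fin n → Fin m → Fin n → Fin m → Carrier) → Matrix (n ℕ.* m) (n ℕ.* m)
  onPairs {n} {m} g k l =
    g (quotient {n} m k) (remainder {n} m k) (quotient {n} m l) (remainder {n} m l)

  onPairs-entry : ∀ {n m} (g : Fin n → Fin m → Fin n → Fin m → Carrier) i x j y →
                  onPairs g (combine {n} {m} i x) (combine {n} {m} j y) ≡ g i x j y
  onPairs-entry {n} {m} g i x j y = ≡.cong₂ (λ (i , x) (j , y) → g i x j y)
    (Fin.remQuot-combine {n} {m} i x) (Fin.remQuot-combine {n} {m} j y)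

  ≋-on-combine : ∀ {n m} {M N : Matrix (n ℕ.* m) (n ℕ.* m)} →
    (∀ (i : Fin n) (x : Fin m) j y →
       M (combine {n} {m} i x) (combine {n} {m} j y) ≈ N (combine {n} {m} i x) (combine {n} {m} j y)) →
    M ≋ N
  ≋-on-combine {n} {m} {M} {N} eq k l = ≡.subst₂ (λ k l → M k l ≈ N k l)
    (Fin.combine-remQuot {n} m k) (Fin.combine-remQuot {n} m l) (eq _ _ _ _)

  ⊗-combine : ∀ {n m} (M N : Matrix (n ℕ.* m) (n ℕ.* m))
    (g h : Fin n → Fin m → Fin n → Fin m → Carrier) →
    (∀ i x j y → M (combine {n} {m} i x) (combine {n} {m} j y) ≈ g i x j y) →
    (∀ i x j y → N (combine {n} {m} i x) (combine {n} {m} j y) ≈ h i x j y) →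
    ∀ i x j y → (M ⊗ N) (combine {n} {m} i x) (combine {n} {m} j y) ≈
                ∑ λ l → ∑ λ z → g i x l z * h l z j y
  ⊗-combine {n} {m} M N g h M≈g N≈h i x j y = trans (∑-combine n m _)
    (∑-cong λ l → ∑-cong λ z → *-cong (M≈g i x l z) (N≈h l z j y))

  δ-combine : ∀ {n m} (i j : Fin n) (x y : Fin m) → δ (combine {n} {m} i x) (combine {n} {m} j y) ≈ δ i j * δ x y
  δ-combine {n} {m} i j x y with i Fin.≟ j
  ... | yes ≡.refl = trans (δ-⇔ (proj₂ ∘ Fin.combine-injective i x i y) (≡.cong (combine {n} {m} i)))
                           (sym (trans (*-congʳ (δ-refl i)) (*-identityˡ _)))
  ... | no i≢j = trans (δ-≢ (i≢j ∘ proj₁ ∘ Fin.combine-injective i x j y))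
                       (sym (trans (*-congʳ (δ-≢ i≢j)) (zeroˡ _)))

  infixr 5 _⊕_
  _⊕_ : Matrix n n → Matrix m m → Matrix (n ℕ.+ m) (n ℕ.+ m)
  A ⊕ D = (λ i → A i ++ λ _ → 0#) ++ (λ i → (λ _ → 0#) ++ D i)

  ++-suc : ∀ {a} {A : Set a} (u : Vector A (suc n)) (w : Vector A m) i → (u ++ w) (suc i) ≡ (tail u ++ w) i
  ++-suc {n = n} u w i with splitAt n i
  ... | inj₁ _ = ≡.refl
  ... | inj₂ _ = ≡.refl

  ++-punchIn : ∀ {a} {A : Set a} (u : Vector A (suc n)) (w : Vector A m) j k →
               (u ++ w) (punchIn (j ↑ˡ m) k) ≡ (removeAt u j ++ w) k
  ++-punchIn u w zero k = ++-suc u w k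
  ++-punchIn {suc n} u w (suc j) zero = ≡.refl
  ++-punchIn {suc n} {m} u w (suc j) (suc k) = ≡.trans (++-suc u w (punchIn (j ↑ˡ m) k))
    (≡.trans (++-punchIn (tail u) w j k) (≡.sym (++-suc (removeAt u (suc j)) w k)))

  minor-⊕ : ∀ (A : Matrix (suc n) (suc n)) (D : Matrix m m) j →
            minor (A ⊕ D) (j ↑ˡ m) ≋ minor A j ⊕ D
  minor-⊕ {n} {m} A D j i k with splitAt n i
  ... | inj₁ i′ = reflexive (++-punchIn (A (suc i′)) (λ _ → 0#) j k)
  ... | inj₂ i′ = reflexive (++-punchIn (λ _ → 0#) (D i′) j k)

  ++-↑ˡ : ∀ {a} {A : Set a} (u : Vector A n) (w : Vector A m) j → (u ++ w) (j ↑ˡ m) ≡ u j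
  ++-↑ˡ {n = n} {m} u w j = ≡.cong [ u , w ] (Fin.splitAt-↑ˡ n j m)

  ++-↑ʳ : ∀ {a} {A : Set a} (u : Vector A n) (w : Vector A m) j → (u ++ w) (n ↑ʳ j) ≡ w j
  ++-↑ʳ {n = n} {m} u w j = ≡.cong [ u , w ] (Fin.splitAt-↑ʳ n m j)

  -- Expand along the first row of `A`: the columns of `D` contribute nothing, and deleting a column
  -- of `A` leaves a block sum with the same `D`.
  det-⊕ : ∀ (A : Matrix n n) (D : Matrix m m) → det (A ⊕ D) ≈ det A * det D
  det-⊕ {zero} A D = trans (det-cong λ i k → refl) (sym (trans (*-congʳ (det-empty A)) (*-identityˡ _)))
  det-⊕ {suc n} {m} A D = begin
    det (A ⊕ D)
      ≈⟨ trans (det-suc (A ⊕ D)) (∑-split (suc n) m _) ⟩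
    ∑ (λ j → sgn (toℕ (j ↑ˡ m)) * ((A ⊕ D) zero (j ↑ˡ m) * det (minor (A ⊕ D) (j ↑ˡ m)))) + ∑ _
      ≈⟨ +-cong (∑-cong λ j → trans (*-cong (reflexive (≡.cong sgn (Fin.toℕ-↑ˡ j m)))
                  (*-cong (reflexive (++-↑ˡ (A zero) (λ _ → 0#) j))
                          (trans (det-cong (minor-⊕ A D j)) (det-⊕ (minor A j) D))))
                  (solve 4 (λ s a d e → s :* (a :* (d :* e)) := (s :* (a :* d)) :* e) refl
                     (sgn (toℕ j)) (A zero j) (det (minor A j)) (det D)))
                (∑-≈0 λ j → trans (*-congˡ (trans (*-congʳ
                  (reflexive (++-↑ʳ (A zero) (λ _ → 0#) j))) (zeroˡ _))) (zeroʳ _)) ⟩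
    ∑ (λ j → sgn (toℕ j) * (A zero j * det (minor A j)) * det D) + 0#
      ≈⟨ +-identityʳ _ ⟩
    ∑ (λ j → sgn (toℕ j) * (A zero j * det (minor A j)) * det D)
      ≈⟨ ∑-* (det D) _ ⟨
    ∑ (λ j → sgn (toℕ j) * (A zero j * det (minor A j))) * det D
      ≈⟨ *-congʳ (det-suc A) ⟨
    det A * det D ∎

  blockDiagonal : (Fin n → Matrix m m) → Matrix (n ℕ.* m) (n ℕ.* m)
  blockDiagonal {zero}  B = λ ()
  blockDiagonal {suc n} B = B zero ⊕ blockDiagonal (B ∘ suc)

  blockDiagonal-entry : ∀ {n m} (B : Fin n → Matrix m m) i x j y →
    blockDiagonal B (combine {n} {m} i x) (combine {n} {m} j y) ≈ δ i j * B i x y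
  blockDiagonal-entry {suc n} {m} B i x j y = helper i j
    where
    D = blockDiagonal (B ∘ suc)
    helper : ∀ i j → blockDiagonal B (combine {suc n} {m} i x) (combine {suc n} {m} j y) ≈ δ i j * B i x y
    helper zero j = trans (reflexive (≡.cong (λ r → r (combine j y))
        (++-↑ˡ (λ i → B zero i ++ λ _ → 0#) (λ i → (λ _ → 0#) ++ D i) x)))
      (first j)
      where
      first : ∀ j → (B zero x ++ λ _ → 0#) (combine j y) ≈ δ zero j * B zero x y
      first zero    = trans (reflexive (++-↑ˡ (B zero x) (λ _ → 0#) y)) (sym (*-identityˡ _))
      first (suc j) = trans (reflexive (++-↑ʳ (B zero x) (λ _ → 0#) (combine j y))) (sym (zeroˡ _))
    helper (suc i) j = trans (reflexive (≡.cong (λ r → r (combine j y))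
        (++-↑ʳ (λ i → B zero i ++ λ _ → 0#) (λ i → (λ _ → 0#) ++ D i) (combine i x))))
      (rest j)
      where
      rest : ∀ j → ((λ _ → 0#) ++ D (combine i x)) (combine j y) ≈ δ (suc i) j * B (suc i) x y
      rest zero    = trans (reflexive (++-↑ˡ (λ _ → 0#) (D (combine i x)) y)) (sym (zeroˡ _))
      rest (suc j) = trans (reflexive (++-↑ʳ {n = m} (λ _ → 0#) (D (combine i x)) (combine j y)))
                           (blockDiagonal-entry (B ∘ suc) i x j y)

  ∏ : (Fin n → Carrier) → Carrier
  ∏ = Vector.foldr _*_ 1#

  det-blockDiagonal : ∀ (B : Fin n → Matrix m m) → det (blockDiagonal B) ≈ ∏ (det ∘ B)
  det-blockDiagonal {zero}  B = det-empty _
  det-blockDiagonal {suc n} B =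
    trans (det-⊕ (B zero) (blockDiagonal (B ∘ suc))) (*-congˡ (det-blockDiagonal (B ∘ suc)))

-- Determinants under ring homomorphisms

module _ {c₁ ℓ₁ c₂ ℓ₂} (R : CommutativeRing c₁ ℓ₁) (S : CommutativeRing c₂ ℓ₂) where
  private
    module R = CommutativeRing R
    module S = CommutativeRing S

  Homomorphism : (R.Carrier → S.Carrier) → Set _
  Homomorphism = IsRingHomomorphism R.rawRing S.rawRing

module DeterminantHomomorphism
  {c₁ ℓ₁ c₂ ℓ₂} {R : CommutativeRing c₁ ℓ₁} {S : CommutativeRing c₂ ℓ₂}
  {h : CommutativeRing.Carrier R → CommutativeRing.Carrier S} (h-hom : Homomorphism R S h) where
  private
    module R = CommutativeRing R
    module DR where
      open Summation R public
      open Determinant R public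
    module DS where
      open Summation S public
      open Determinant S public
  open CommutativeRing S hiding (zero)
  open IsRingHomomorphism h-hom

  ∑-homo : ∀ {n} (f : Fin n → R.Carrier) → h (DR.∑ f) ≈ DS.∑ (h ∘ f)
  ∑-homo {zero}  f = trans (⟦⟧-cong (DR.∑-empty f)) (trans 0#-homo (sym (DS.∑-empty _)))
  ∑-homo {suc n} f = trans (⟦⟧-cong (DR.∑-suc f))
    (trans (+-homo _ _) (trans (+-congˡ (∑-homo (f ∘ suc))) (sym (DS.∑-suc _))))

  sgn-homo : ∀ k → h (DR.sgn k) ≈ DS.sgn k
  sgn-homo zero    = 1#-homo
  sgn-homo (suc k) = trans (-‿homo _) (-‿cong (sgn-homo k))

  -- A determinant is an integer polynomial in the entries. This links the four kinds of entries
  -- that occur: integers, elements of ℤ[F], their images under `push c`, and their classes in the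
  -- quotient.
  det-homo : ∀ {n} (M : DR.Matrix n n) → h (DR.det M) ≈ DS.det (λ i j → h (M i j))
  det-homo {zero}  M = trans (⟦⟧-cong (DR.det-empty M)) (trans 1#-homo (sym (DS.det-empty _)))
  det-homo {suc n} M = trans (⟦⟧-cong (DR.det-suc M)) (trans (∑-homo _) (trans
    (DS.∑-cong λ j → trans (*-homo _ _) (*-cong (sgn-homo (toℕ j))
      (trans (*-homo _ _) (*-congˡ (det-homo (DR.minor M j))))))
    (sym (DS.det-suc _))))

open ≡ using (refl; sym; trans; cong; cong₂; subst)

-- The group ring of the additive group of a finite ring

ℤ-ring : CommutativeRing 0ℓ 0ℓ
ℤ-ring = ℤ.+-*-commutativeRing

module Z where
  open Summation ℤ-ring public
  open Determinant ℤ-ring public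

homomorphism : ∀ {a₁ ℓ₁ a₂ ℓ₂} {R : RawRing a₁ ℓ₁} {S : RawRing a₂ ℓ₂} →
  let module R = RawRing R; module S = RawRing S in
  {h : R.Carrier → S.Carrier} →
  (∀ {x y} → x R.≈ y → h x S.≈ h y) →
  (∀ x y → h (x R.+ y) S.≈ (h x S.+ h y)) →
  (∀ x y → h (x R.* y) S.≈ (h x S.* h y)) →
  (∀ x → h (R.- x) S.≈ (S.- h x)) →
  h R.0# S.≈ S.0# → h R.1# S.≈ S.1# →
  IsRingHomomorphism R S h
homomorphism cong +-homo *-homo -‿homo 0#-homo 1#-homo = record
  { isSemiringHomomorphism = record
    { isNearSemiringHomomorphism = record
      { +-isMonoidHomomorphism = record
        { isMagmaHomomorphism = record { isRelHomomorphism = record { cong = cong } ; homo = +-homo }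
        ; ε-homo = 0#-homo
        }
      ; *-homo = *-homo
      }
    ; 1#-homo = 1#-homo
    }
  ; -‿homo = -‿homo
  }


module GroupRing
  {q : ℕ} {add mul : Fin q → Fin q → Fin q} {neg : Fin q → Fin q} {0# 1# : Fin q}
  (isCommutativeRing : IsCommutativeRing _≡_ add mul neg 0# 1#) where

  private
    F : CommutativeRing 0ℓ 0ℓ
    F = record { isCommutativeRing = isCommutativeRing }
    module F = CommutativeRing F
    open F using (_+_; _*_; -_; _-_)
    open import Algebra.Properties.AbelianGroup F.+-abelianGroup
      using (//-rightDividesˡ; //-rightDividesʳ; ⁻¹-anti-homo-//; ⁻¹-∙-comm)
  open Summation ℤ-ring

  Element : Set
  Element = Fin q → ℤ

  sub-add : ∀ s t → (s - t) + t ≡ s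
  sub-add s t = //-rightDividesˡ t s

  add-sub : ∀ s t → (s + t) - t ≡ s
  add-sub s t = //-rightDividesʳ t s

  sub-sub : ∀ s t → s - (s - t) ≡ t
  sub-sub s t = begin
    s + (- (s - t))  ≡⟨ cong (s +_) (⁻¹-anti-homo-// s t) ⟩
    s + (t - s)      ≡⟨ F.+-comm s (t - s) ⟩
    (t - s) + s      ≡⟨ sub-add t s ⟩
    t                ∎
    where open ≡.≡-Reasoning

  sub-+ : ∀ s t r → s - (t + r) ≡ (s - r) - t
  sub-+ s t r = begin
    s + (- (t + r))          ≡⟨ cong (λ x → s + (- x)) (F.+-comm t r) ⟩
    s + (- (r + t))          ≡⟨ cong (s +_) (⁻¹-∙-comm r t) ⟨
    s + ((- r) + (- t))      ≡⟨ F.+-assoc s (- r) (- t) ⟨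
    (s - r) - t              ∎
    where open ≡.≡-Reasoning

  reflect : Fin q → Permutation q q
  reflect s = Perm.permutation (λ t → s - t) (λ t → s - t) (sub-sub s) (sub-sub s)

  translate : Fin q → Permutation q q
  translate s = Perm.permutation (_+ s) (λ t → t - s) (λ t → sub-add t s) (λ t → add-sub t s)

  infixl 7 _⋆_
  infixl 6 _⊞_
  _⊞_ : Element → Element → Element
  (f ⊞ g) s = f s ℤ.+ g s

  opaque
    _⋆_ : Element → Element → Element
    (f ⋆ g) s = ∑ λ t → f t ℤ.* g (s - t)

  ⊟_ : Element → Element
  (⊟ f) s = ℤ.- f s

  ι : ℤ → Element
  ι z s = z ℤ.* δ 0# s

  [_] : Fin q → Element
  [ t ] = δ t

  private module _ where
    open ≡.≡-Reasoning

    opaque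
      unfolding _⋆_

      ⋆-cong : ∀ {f f′ g g′} → f ≗ f′ → g ≗ g′ → f ⋆ g ≗ f′ ⋆ g′
      ⋆-cong f≗ g≗ s = ∑-cong λ t → cong₂ ℤ._*_ (f≗ t) (g≗ (s - t))

    opaque
      unfolding _⋆_

      ⋆-comm : ∀ f g → f ⋆ g ≗ g ⋆ f
      ⋆-comm f g s = begin
        ∑ (λ t → f t ℤ.* g (s - t))                   ≡⟨ ∑-permute _ (reflect s) ⟩
        ∑ (λ t → f (s - t) ℤ.* g (s - (s - t)))       ≡⟨ ∑-cong (λ t → cong (λ x → f (s - t) ℤ.* g x) (sub-sub s t)) ⟩
        ∑ (λ t → f (s - t) ℤ.* g t)                   ≡⟨ ∑-cong (λ t → ℤ.*-comm (f (s - t)) (g t)) ⟩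
        ∑ (λ t → g t ℤ.* f (s - t))                   ∎

    -- The interchange of sums common to associativity of convolution and multiplicativity of
    -- `push`.
    ∑-⋆ : ∀ (f : Element) (a : Fin q → Element) (b : Element) →
          ∑ (λ w → ∑ (λ t → f t ℤ.* a t w) ℤ.* b w) ≡ ∑ λ t → f t ℤ.* ∑ λ w → a t w ℤ.* b w
    ∑-⋆ f a b = begin
      ∑ (λ w → ∑ (λ t → f t ℤ.* a t w) ℤ.* b w)
        ≡⟨ ∑-cong (λ w → trans (∑-* (b w) _) (∑-cong λ t → ℤ.*-assoc (f t) (a t w) (b w))) ⟩
      ∑ (λ w → ∑ λ t → f t ℤ.* (a t w ℤ.* b w))
        ≡⟨ ∑-comm _ ⟩
      ∑ (λ t → ∑ λ w → f t ℤ.* (a t w ℤ.* b w))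
        ≡⟨ ∑-cong (λ t → *-∑ (f t) _) ⟨
      ∑ (λ t → f t ℤ.* ∑ λ w → a t w ℤ.* b w) ∎

    opaque
      unfolding _⋆_

      ⋆-assoc : ∀ f g h → (f ⋆ g) ⋆ h ≗ f ⋆ (g ⋆ h)
      ⋆-assoc f g h s = begin
        ∑ (λ t → ∑ (λ r → f r ℤ.* g (t - r)) ℤ.* h (s - t))
          ≡⟨ ∑-⋆ f (λ r t → g (t - r)) (λ t → h (s - t)) ⟩
        ∑ (λ r → f r ℤ.* ∑ λ t → g (t - r) ℤ.* h (s - t))
          ≡⟨ ∑-cong (λ r → cong (f r ℤ.*_) (trans (∑-permute _ (translate r))
               (∑-cong λ t → cong₂ (λ x y → g x ℤ.* h y) (add-sub t r) (sub-+ s t r)))) ⟩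
        ∑ (λ r → f r ℤ.* ∑ λ t → g t ℤ.* h ((s - r) - t)) ∎

      ⋆-distribˡ : ∀ f g h → f ⋆ (g ⊞ h) ≗ (f ⋆ g) ⊞ (f ⋆ h)
      ⋆-distribˡ f g h s = trans (∑-cong λ t → ℤ.*-distribˡ-+ (f t) _ _) (∑-+ _ _)

      ⋆-distribʳ : ∀ f g h → (g ⊞ h) ⋆ f ≗ (g ⋆ f) ⊞ (h ⋆ f)
      ⋆-distribʳ f g h s = trans (∑-cong λ t → ℤ.*-distribʳ-+ (f (s - t)) (g t) (h t)) (∑-+ _ _)

  opaque
    unfolding _⋆_

    ι-⋆ : ∀ z f s → (ι z ⋆ f) s ≡ z ℤ.* f s
    ι-⋆ z f s = begin
      ∑ (λ t → z ℤ.* δ 0# t ℤ.* f (s - t))      ≡⟨ ∑-cong (λ t → ℤ.*-assoc z _ _) ⟩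
      ∑ (λ t → z ℤ.* (δ 0# t ℤ.* f (s - t)))    ≡⟨ *-∑ z _ ⟨
      z ℤ.* ∑ (λ t → δ 0# t ℤ.* f (s - t))      ≡⟨ cong (z ℤ.*_) (∑-δˡ 0# _) ⟩
      z ℤ.* f (s - 0#)                          ≡⟨ cong (λ x → z ℤ.* f x) (trans (sym (F.+-identityʳ _)) (sub-add s 0#)) ⟩
      z ℤ.* f s                                 ∎
      where open ≡.≡-Reasoning

  private
    ⋆-identityˡ : ∀ f → ι 1ℤ ⋆ f ≗ f
    ⋆-identityˡ f s = trans (ι-⋆ 1ℤ f s) (ℤ.*-identityˡ (f s))

  ℤ[F] : CommutativeRing 0ℓ 0ℓ
  ℤ[F] = record
    { Carrier = Element
    ; _≈_ = _≗_
    ; _+_ = _⊞_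
    ; _*_ = _⋆_
    ; -_ = ⊟_
    ; 0# = λ _ → 0ℤ
    ; 1# = ι 1ℤ
    ; isCommutativeRing = record
      { isRing = record
        { +-isAbelianGroup = record
          { isGroup = record
            { isMonoid = record
              { isSemigroup = record
                { isMagma = record
                  { isEquivalence = record
                    { refl = λ _ → refl ; sym = λ p s → sym (p s) ; trans = λ p q s → trans (p s) (q s) }
                  ; ∙-cong = λ p q s → cong₂ ℤ._+_ (p s) (q s)
                  }
                ; assoc = λ f g h s → ℤ.+-assoc (f s) (g s) (h s)
                }
              ; identity = (λ f s → ℤ.+-identityˡ (f s)) , (λ f s → ℤ.+-identityʳ (f s))
              }
            ; inverse = (λ f s → ℤ.+-inverseˡ (f s)) , (λ f s → ℤ.+-inverseʳ (f s))
            ; ⁻¹-cong = λ p s → cong ℤ.-_ (p s)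
            }
          ; comm = λ f g s → ℤ.+-comm (f s) (g s)
          }
        ; *-cong = ⋆-cong
        ; *-assoc = ⋆-assoc
        ; *-identity = ⋆-identityˡ , (λ f s → trans (⋆-comm f (ι 1ℤ) s) (⋆-identityˡ f s))
        ; distrib = ⋆-distribˡ , ⋆-distribʳ
        }
      ; *-comm = ⋆-comm
      }
    }

  -- ℤ[F] modulo the multiples of ∑ₜ[ t ], i.e. modulo the constant functions.
  infix 4 _~_
  record _~_ (f g : Element) : Set where
    constructor up-to
    field
      constant : ℤ
      equality : ∀ s → f s ≡ g s ℤ.+ constant

  ≗⇒~ : ∀ {f g} → f ≗ g → f ~ g
  ≗⇒~ f≗g = up-to 0ℤ λ s → trans (f≗g s) (sym (ℤ.+-identityʳ _))

  private
    ~-sym : ∀ {f g} → f ~ g → g ~ f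
    ~-sym {f} {g} (up-to k eq) = up-to (ℤ.- k) λ s → trans (lemma (g s) k) (cong (ℤ._- k) (sym (eq s)))
      where
      lemma : ∀ x k → x ≡ (x ℤ.+ k) ℤ.- k
      lemma = solve-∀

    ~-trans : ∀ {f g h} → f ~ g → g ~ h → f ~ h
    ~-trans {h = h} (up-to k p) (up-to l q) = up-to (l ℤ.+ k) λ s →
      trans (p s) (trans (cong (ℤ._+ k) (q s)) (ℤ.+-assoc (h s) l k))

    ~-⊞ : ∀ {f f′ g g′} → f ~ f′ → g ~ g′ → f ⊞ g ~ f′ ⊞ g′
    ~-⊞ {f′ = f′} {g′ = g′} (up-to k p) (up-to l q) = up-to (k ℤ.+ l) λ s →
      trans (cong₂ ℤ._+_ (p s) (q s)) (lemma (f′ s) k (g′ s) l)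
      where
      lemma : ∀ x k y l → (x ℤ.+ k) ℤ.+ (y ℤ.+ l) ≡ (x ℤ.+ y) ℤ.+ (k ℤ.+ l)
      lemma = solve-∀

    ~-⊟ : ∀ {f g} → f ~ g → ⊟ f ~ ⊟ g
    ~-⊟ {g = g} (up-to k p) = up-to (ℤ.- k) λ s → trans (cong ℤ.-_ (p s)) (ℤ.neg-distrib-+ (g s) k)

    opaque
      unfolding _⋆_

      -- The constants form an ideal: convolving the constant `k` with `g` gives `k` times the
      -- augmentation of `g`.
      ~-⋆ˡ : ∀ {f f′} g → f ~ f′ → f ⋆ g ~ f′ ⋆ g
      ~-⋆ˡ {f} {f′} g (up-to k p) = up-to (k ℤ.* ∑ g) λ s → begin
        ∑ (λ t → f t ℤ.* g (s - t))
          ≡⟨ ∑-cong (λ t → trans (cong (ℤ._* g (s - t)) (p t)) (ℤ.*-distribʳ-+ (g (s - t)) (f′ t) k)) ⟩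
        ∑ (λ t → f′ t ℤ.* g (s - t) ℤ.+ k ℤ.* g (s - t))
          ≡⟨ ∑-+ _ _ ⟩
        (f′ ⋆ g) s ℤ.+ ∑ (λ t → k ℤ.* g (s - t))
          ≡⟨ cong (λ x → (f′ ⋆ g) s ℤ.+ x) (*-∑ k _) ⟨
        (f′ ⋆ g) s ℤ.+ k ℤ.* ∑ (λ t → g (s - t))
          ≡⟨ cong (λ x → (f′ ⋆ g) s ℤ.+ k ℤ.* x) (∑-permute g (reflect s)) ⟨
        (f′ ⋆ g) s ℤ.+ k ℤ.* ∑ g ∎
        where open ≡.≡-Reasoning

    ~-⋆ : ∀ {f f′ g g′} → f ~ f′ → g ~ g′ → f ⋆ g ~ f′ ⋆ g′
    ~-⋆ {f} {f′} {g} {g′} p q = ~-trans (~-⋆ˡ g p)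
      (~-trans (≗⇒~ (⋆-comm f′ g))
        (~-trans (~-⋆ˡ f′ q) (≗⇒~ (⋆-comm g′ f′))))

  ℤ[F]/∑ : CommutativeRing 0ℓ 0ℓ
  ℤ[F]/∑ = record
    { Carrier = Element
    ; _≈_ = _~_
    ; _+_ = _⊞_
    ; _*_ = _⋆_
    ; -_ = ⊟_
    ; 0# = λ _ → 0ℤ
    ; 1# = ι 1ℤ
    ; isCommutativeRing = record
      { isRing = record
        { +-isAbelianGroup = record
          { isGroup = record
            { isMonoid = record
              { isSemigroup = record
                { isMagma = record
                  { isEquivalence = record
                    { refl = ≗⇒~ λ _ → refl
                    ; sym = ~-sym
                    ; trans = ~-trans
                    }
                  ; ∙-cong = ~-⊞
                  }
                ; assoc = λ f g h → ≗⇒~ (R.+-assoc f g h)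
                }
              ; identity = (λ f → ≗⇒~ (R.+-identityˡ f)) , (λ f → ≗⇒~ (R.+-identityʳ f))
              }
            ; inverse = (λ f → ≗⇒~ (R.-‿inverseˡ f)) , (λ f → ≗⇒~ (R.-‿inverseʳ f))
            ; ⁻¹-cong = ~-⊟
            }
          ; comm = λ f g → ≗⇒~ (R.+-comm f g)
          }
        ; *-cong = ~-⋆
        ; *-assoc = λ f g h → ≗⇒~ (R.*-assoc f g h)
        ; *-identity = (λ f → ≗⇒~ (R.*-identityˡ f)) , (λ f → ≗⇒~ (R.*-identityʳ f))
        ; distrib = (λ f g h → ≗⇒~ (R.distribˡ f g h)) , (λ f g h → ≗⇒~ (R.distribʳ f g h))
        }
      ; *-comm = λ f g → ≗⇒~ (R.*-comm f g)
      }
    }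
    where module R = CommutativeRing ℤ[F]

  ι-homomorphism : Homomorphism ℤ-ring ℤ[F] ι
  ι-homomorphism = homomorphism
    (λ { refl _ → refl })
    (λ z w s → ℤ.*-distribʳ-+ (δ 0# s) z w)
    (λ z w s → trans (ℤ.*-assoc z w (δ 0# s)) (sym (ι-⋆ z (ι w) s)))
    (λ z s → sym (ℤ.neg-distribˡ-* z (δ 0# s)))
    (λ s → ℤ.*-zeroˡ (δ 0# s))
    (λ s → refl)

  quotient-homomorphism : Homomorphism ℤ[F] ℤ[F]/∑ (λ f → f)
  quotient-homomorphism = homomorphism ≗⇒~ (λ _ _ → ~refl) (λ _ _ → ~refl) (λ _ → ~refl) ~refl ~refl
    where
    ~refl : ∀ {f} → f ~ f
    ~refl = ≗⇒~ λ _ → refl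

  opaque
    unfolding _⋆_

    []-⋆ : ∀ a b → [ a ] ⋆ [ b ] ≗ [ a + b ]
    []-⋆ a b s = trans (∑-δˡ a _) (δ-⇔
      (λ b≡s-a → trans (F.+-comm a b) (trans (cong (_+ a) b≡s-a) (sub-add s a)))
      (λ a+b≡s → trans (sym (add-sub b a)) (cong (λ x → x - a) (trans (F.+-comm b a) a+b≡s))))

  -- The linear extension of `[ t ]` ↦ `[ λ′ * t ]`, written c_* above. The multiplier 0 is allowed
  -- and collapses an element to its augmentation.
  push : Fin q → Element → Element
  push λ′ f s = ∑ λ t → f t ℤ.* δ (λ′ * t) s

  shift-δ : ∀ c t u s → δ (c * (u + t)) s ≡ δ (c * u) (s - c * t)
  shift-δ c t u s = δ-⇔
    (λ eq → trans (sym (add-sub (c * u) (c * t))) (cong (λ x → x - c * t) (trans (sym (F.distribˡ c u t)) eq)))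
    (λ eq → trans (F.distribˡ c u t) (trans (cong (_+ (c * t)) eq) (sub-add s (c * t))))

  opaque
    unfolding _⋆_

    push-⋆ : ∀ c f g → push c (f ⋆ g) ≗ push c f ⋆ push c g
    push-⋆ c f g s = begin
      ∑ (λ w → ∑ (λ t → f t ℤ.* g (w - t)) ℤ.* δ (c * w) s)
        ≡⟨ ∑-⋆ f (λ t w → g (w - t)) (λ w → δ (c * w) s) ⟩
      ∑ (λ t → f t ℤ.* ∑ λ w → g (w - t) ℤ.* δ (c * w) s)
        ≡⟨ ∑-cong (λ t → cong (f t ℤ.*_) (trans (∑-permute _ (translate t))
             (∑-cong λ u → cong₂ ℤ._*_ (cong g (add-sub u t)) (shift-δ c t u s)))) ⟩
      ∑ (λ t → f t ℤ.* push c g (s - c * t))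
        ≡⟨ ∑-cong (λ t → cong (f t ℤ.*_) (∑-δˡ (c * t) (λ r → push c g (s - r)))) ⟨
      ∑ (λ t → f t ℤ.* ∑ λ r → δ (c * t) r ℤ.* push c g (s - r))
        ≡⟨ ∑-⋆ f (λ t r → δ (c * t) r) (λ r → push c g (s - r)) ⟨
      (push c f ⋆ push c g) s ∎
      where open ≡.≡-Reasoning

  push-homomorphism : ∀ c → Homomorphism ℤ[F] ℤ[F] (push c)
  push-homomorphism c = homomorphism
    (λ f≗g s → ∑-cong λ t → cong (ℤ._* δ (c * t) s) (f≗g t))
    (λ f g s → trans (∑-cong λ t → ℤ.*-distribʳ-+ (δ (c * t) s) (f t) (g t)) (∑-+ _ _))
    (push-⋆ c)
    push-⊟
    (λ s → ∑-≈0 λ t → ℤ.*-zeroˡ (δ (c * t) s))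
    push-1
    where
    open ≡.≡-Reasoning
    push-⊟ : ∀ f s → push c (⊟ f) s ≡ ℤ.- push c f s
    push-⊟ f s = begin
      ∑ (λ t → ℤ.- f t ℤ.* δ (c * t) s)           ≡⟨ ∑-cong (λ t → lemma (f t) (δ (c * t) s)) ⟩
      ∑ (λ t → ℤ.-1ℤ ℤ.* (f t ℤ.* δ (c * t) s))   ≡⟨ *-∑ ℤ.-1ℤ _ ⟨
      ℤ.-1ℤ ℤ.* push c f s                        ≡⟨ ℤ.-1*i≡-i _ ⟩
      ℤ.- push c f s ∎
      where
      lemma : ∀ x y → ℤ.- x ℤ.* y ≡ ℤ.-1ℤ ℤ.* (x ℤ.* y)
      lemma = solve-∀

    push-1 : push c (ι 1ℤ) ≗ ι 1ℤ
    push-1 s = begin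
      ∑ (λ t → 1ℤ ℤ.* δ 0# t ℤ.* δ (c * t) s)  ≡⟨ ∑-cong (λ t → cong (ℤ._* δ (c * t) s) (ℤ.*-identityˡ (δ 0# t))) ⟩
      ∑ (λ t → δ 0# t ℤ.* δ (c * t) s)         ≡⟨ ∑-δˡ 0# _ ⟩
      δ (c * 0#) s                             ≡⟨ cong (λ x → δ x s) (F.zeroʳ c) ⟩
      δ 0# s                                   ≡⟨ ℤ.*-identityˡ _ ⟨
      ι 1ℤ s                                   ∎

-- Factorisation of the determinant

∑-const : ∀ n c → Z.∑ {n} (λ _ → c) ≡ ℤ.+ n ℤ.* c
∑-const zero    c = trans (Z.∑-empty _) (sym (ℤ.*-zeroˡ c))
∑-const (suc n) c = trans (Z.∑-suc _)
  (trans (cong (λ x → c ℤ.+ x) (∑-const n c)) (sym (ℤ.suc-* (ℤ.+ n) c)))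

-- The field lives on `Fin (suc N)` with `zero` as its 0. Thus `suc` enumerates F*, and `Fin N`
-- serves as index set for the blocks.
module FiniteField
  {N : ℕ} {add mul : Fin (suc N) → Fin (suc N) → Fin (suc N)} {neg : Fin (suc N) → Fin (suc N)}
  {1# : Fin (suc N)} (isCommutativeRing : IsCommutativeRing _≡_ add mul neg zero 1#)
  (inverse : ∀ i → ∃[ y ] mul y (suc i) ≡ 1#) where

  q : ℕ
  q = suc N

  open GroupRing isCommutativeRing public
  F : CommutativeRing 0ℓ 0ℓ
  F = record { isCommutativeRing = isCommutativeRing }
  module F = CommutativeRing F
  open F using (_+_; _*_; -_; _-_)
  open import Algebra.Properties.AbelianGroup F.+-abelianGroup using (⁻¹-involutive; inverseˡ-unique)
  open import Algebra.Properties.Ring F.ring using (-‿distribʳ-*)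
  module Q where
    open CommutativeRing ℤ[F]/∑ public
    open Summation ℤ[F]/∑ public
    open Determinant ℤ[F]/∑ public
  module R where
    open CommutativeRing ℤ[F] public
    open Summation ℤ[F] public
    open Determinant ℤ[F] public

  ∑~pointwise : ∀ {n} (f : Fin n → Element) → Q.∑ f ~ λ s → Z.∑ λ i → f i s
  ∑~pointwise {zero}  f = Q.trans (Q.∑-empty f) (≗⇒~ λ s → sym (Z.∑-empty _))
  ∑~pointwise {suc n} f = Q.trans (Q.∑-suc f)
    (Q.trans (Q.+-congˡ {f zero} (∑~pointwise (f ∘ suc))) (≗⇒~ λ s → sym (Z.∑-suc _)))

  push~∑ : ∀ c f → push c f ~ Q.∑ λ t → ι (f t) ⋆ [ c * t ]
  push~∑ c f = Q.sym (Q.trans (∑~pointwise _) (≗⇒~ λ s → Z.∑-cong λ t → ι-⋆ (f t) [ c * t ] s))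

  -- A character is an eigenvector of convolution by `f`, with eigenvalue `push c f`: substitute s +
  -- t for s and use that characters are multiplicative.
  []-⋆-∑ : ∀ c t (f : Element) → Q.∑ (λ s → [ c * s ] ⋆ ι (f (s - t))) ~ push c f ⋆ [ c * t ]
  []-⋆-∑ c t f = begin
    Q.∑ (λ s → [ c * s ] ⋆ ι (f (s - t)))
      ≈⟨ Q.∑-permute _ (translate t) ⟩
    Q.∑ (λ s → [ c * (s + t) ] ⋆ ι (f ((s + t) - t)))
      ≈⟨ Q.∑-cong (λ s → Q.trans (Q.*-comm _ _) (Q.*-cong
           (Q.reflexive (cong (ι ∘ f) (add-sub s t)))
           (Q.trans (Q.reflexive (cong [_] (F.distribˡ c s t))) (Q.sym (≗⇒~ ([]-⋆ (c * s) (c * t))))))) ⟩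
    Q.∑ (λ s → ι (f s) ⋆ ([ c * s ] ⋆ [ c * t ]))
      ≈⟨ Q.∑-cong (λ s → Q.*-assoc _ _ _) ⟨
    Q.∑ (λ s → ι (f s) ⋆ [ c * s ] ⋆ [ c * t ])
      ≈⟨ Q.∑-* [ c * t ] _ ⟨
    Q.∑ (λ s → ι (f s) ⋆ [ c * s ]) ⋆ [ c * t ]
      ≈⟨ Q.*-congʳ (push~∑ c f) ⟨
    push c f ⋆ [ c * t ] ∎
    where open ≈-Reasoning Q.setoid

  nonzero-inverse : ∀ {u} → u ≢ zero → ∃[ v ] v * u ≡ 1#
  nonzero-inverse {zero}  u≢0 = contradiction refl u≢0
  nonzero-inverse {suc i} u≢0 = inverse i

  cancel : ∀ {u v} → v * u ≡ 1# → ∀ x → v * (u * x) ≡ x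
  cancel {u} {v} vu≡1 x = trans (sym (F.*-assoc v u x)) (trans (cong (_* x) vu≡1) (F.*-identityˡ x))

  -- The summand is `[ c * (t - s) ]`. It is the unit for every c if s = t; otherwise c ↦ c(t - s)
  -- permutes F, and the sum is the element that the quotient kills.
  orthogonality : ∀ s t → Q.∑ (λ c → [ - (c * s) ] ⋆ [ c * t ]) ~ ι (ℤ.+ q) ⋆ Q.δ s t
  orthogonality s t = Q.trans (Q.∑-cong λ c → ≗⇒~ ([]-⋆ _ _)) (Q.trans (∑~pointwise _) evaluate)
    where
    difference : ∀ c → - (c * s) + c * t ≡ c * (t - s)
    difference c = trans (F.+-comm _ _) (trans (cong (c * t +_) (-‿distribʳ-* c s)) (sym (F.distribˡ c t (- s))))

    evaluate : (λ r → Z.∑ λ c → Z.δ (- (c * s) + c * t) r) ~ ι (ℤ.+ q) ⋆ Q.δ s t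
    evaluate with s Fin.≟ t
    ... | yes refl = Q.trans
      (≗⇒~ λ r → trans (Z.∑-cong λ c → cong (λ x → Z.δ x r) (F.-‿inverseˡ (c * s))) (∑-const q (Z.δ zero r)))
      (Q.sym (Q.trans (Q.*-congˡ (Q.δ-refl s)) (Q.*-identityʳ _)))
    ... | no s≢t = Q.trans
      -- The constant is 1, since each `r` equals `u * c` for exactly one `c`, namely `v * r`.
      (up-to 1ℤ λ r → trans (Z.∑-cong λ c → trans
          (trans (cong (λ x → Z.δ x r) (trans (difference c) (F.*-comm c u))) (Z.δ-⇔
            (λ uc≡r → trans (cong (v *_) (sym uc≡r)) (cancel {u} vu≡1 c))
            (λ vr≡c → trans (cong (u *_) (sym vr≡c)) (cancel {v} {u} (trans (F.*-comm u v) vu≡1) r))))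
          (sym (ℤ.*-identityʳ _)))
        (Z.∑-δˡ (v * r) (λ _ → 1ℤ)))
      (Q.sym (Q.trans (Q.*-congˡ (Q.δ-≢ s≢t)) (Q.zeroʳ (ι (ℤ.+ q)))))
      where
      u = t - s
      u≢0 : u ≢ zero
      u≢0 u≡0 = s≢t (sym (trans (inverseˡ-unique t (- s) u≡0) (⁻¹-involutive s)))
      v = proj₁ (nonzero-inverse u≢0)
      vu≡1 = proj₂ (nonzero-inverse u≢0)

  -- The quotient is free of integer torsion: if z(f - g) is constant, then so is f - g, and its
  -- value can be read off at `zero`.
  ι-cancel : ∀ z .{{_ : ℤ.NonZero z}} {f g} → ι z ⋆ f ~ ι z ⋆ g → f ~ g
  ι-cancel z {f} {g} (up-to k eq) = up-to (f zero ℤ.- g zero) λ s →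
    ℤ.*-cancelˡ-≡ z _ _ (begin
      z ℤ.* f s                                     ≡⟨ lemma₁ (z ℤ.* f s) (z ℤ.* f zero) ⟩
      z ℤ.* f s ℤ.+ (z ℤ.* f zero ℤ.- z ℤ.* f zero) ≡⟨ cong₂ (λ x y → x ℤ.+ (z ℤ.* f zero ℤ.- y)) (zf s) (zf zero) ⟩
      z ℤ.* g s ℤ.+ k ℤ.+ (z ℤ.* f zero ℤ.- (z ℤ.* g zero ℤ.+ k)) ≡⟨ lemma₂ z (g s) k (f zero) (g zero) ⟩
      z ℤ.* (g s ℤ.+ (f zero ℤ.- g zero))           ∎)
    where
    open ≡.≡-Reasoning
    zf : ∀ s → z ℤ.* f s ≡ z ℤ.* g s ℤ.+ k
    zf s = trans (sym (ι-⋆ z f s)) (trans (eq s) (cong (ℤ._+ k) (ι-⋆ z g s)))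
    lemma₁ : ∀ x y → x ≡ x ℤ.+ (y ℤ.- y)
    lemma₁ = solve-∀
    lemma₂ : ∀ z x k a b → z ℤ.* x ℤ.+ k ℤ.+ (z ℤ.* a ℤ.- (z ℤ.* b ℤ.+ k)) ≡ z ℤ.* (x ℤ.+ (a ℤ.- b))
    lemma₂ = solve-∀

  open import Algebra.Properties.Semiring.Exp Q.semiring using () renaming (_^_ to _^^_)

  ι-^-cancel : ∀ z .{{_ : ℤ.NonZero z}} n {f g} → (ι z ^^ n) ⋆ f ~ (ι z ^^ n) ⋆ g → f ~ g
  ι-^-cancel z zero    {f} {g} eq = Q.trans (Q.sym (Q.*-identityˡ f)) (Q.trans eq (Q.*-identityˡ g))
  ι-^-cancel z (suc n) {f} {g} eq = ι-^-cancel z n (ι-cancel z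
    (Q.trans (Q.sym (Q.*-assoc _ _ f)) (Q.trans eq (Q.*-assoc _ _ g))))

  -- Both functions vanish at `1#`, which differs from `zero`, so the constant between them is 0.
  ι-injective : 1# ≢ zero → ∀ {z w} → ι z ~ ι w → z ≡ w
  ι-injective 1≢0 {z} {w} (up-to k eq) = begin
    z                      ≡⟨ ℤ.*-identityʳ z ⟨
    ι z zero               ≡⟨ eq zero ⟩
    ι w zero ℤ.+ k         ≡⟨ cong (λ x → ι w zero ℤ.+ x) k≡0 ⟩
    w ℤ.* 1ℤ ℤ.+ 0ℤ        ≡⟨ trans (ℤ.+-identityʳ _) (ℤ.*-identityʳ w) ⟩
    w                      ∎
    where
    open ≡.≡-Reasoning
    at-1 : ∀ x → ι x 1# ≡ 0ℤ
    at-1 x = trans (cong (x ℤ.*_) (Z.δ-≢ (1≢0 ∘ sym))) (ℤ.*-zeroʳ x)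
    k≡0 : k ≡ 0ℤ
    k≡0 = begin
      k                   ≡⟨ ℤ.+-identityˡ k ⟨
      0ℤ ℤ.+ k            ≡⟨ cong (ℤ._+ k) (at-1 w) ⟨
      ι w 1# ℤ.+ k        ≡⟨ eq 1# ⟨
      ι z 1#              ≡⟨ at-1 z ⟩
      0ℤ                  ∎

  ι-homomorphismQ : Homomorphism ℤ-ring ℤ[F]/∑ ι
  ι-homomorphismQ = homomorphism
    (λ eq → ≗⇒~ (⟦⟧-cong eq)) (λ x y → ≗⇒~ (+-homo x y)) (λ x y → ≗⇒~ (*-homo x y))
    (λ x → ≗⇒~ (-‿homo x)) (≗⇒~ 0#-homo) (≗⇒~ 1#-homo)
    where open IsRingHomomorphism ι-homomorphism

  module _ {m} (β : Fin m → Fin m → Element) where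
    open ≈-Reasoning Q.setoid

    -- In the coordinates (s , x) ↦ (x, xs) of GA(1, q) this is the group matrix.
    regular : Z.Matrix (q ℕ.* m) (q ℕ.* m)
    regular = Z.onPairs λ s x t y → β x y (s - t)

    private
      m×m = q ℕ.* m
      -- T is the table of the characters s ↦ [ c * s ] and S that of their inverses.
      S T M B : Q.Matrix m×m m×m
      S = Q.onPairs λ s i c x → Q.δ i x ⋆ [ - (c * s) ]
      T = Q.onPairs λ c x s i → Q.δ x i ⋆ [ c * s ]
      M k l = ι (regular k l)
      B = Q.blockDiagonal λ c x y → push c (β x y)

      S-entry = λ s i c x → Q.reflexive (Q.onPairs-entry {q} {m} (λ s i c x → Q.δ i x ⋆ [ - (c * s) ]) s i c x)
      T-entry = λ c x s i → Q.reflexive (Q.onPairs-entry {q} {m} (λ c x s i → Q.δ x i ⋆ [ c * s ]) c x s i)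
      M-entry = λ s x t y → Q.reflexive (cong ι (Z.onPairs-entry {q} {m} (λ s x t y → β x y (s - t)) s x t y))

      ST≈q : S Q.⊗ T Q.≋ λ k l → ι (ℤ.+ q) ⋆ Q.δ k l
      ST≈q = Q.≋-on-combine {q} {m} λ s i t j → begin
        (S Q.⊗ T) (combine s i) (combine t j)
          ≈⟨ Q.⊗-combine S T _ _ S-entry T-entry s i t j ⟩
        Q.∑ (λ c → Q.∑ λ x → Q.δ i x ⋆ [ - (c * s) ] ⋆ (Q.δ x j ⋆ [ c * t ]))
          ≈⟨ Q.∑-cong (λ c → Q.trans (Q.∑-cong λ x → Q.*-assoc (Q.δ i x) _ _) (Q.∑-δˡ i _)) ⟩
        Q.∑ (λ c → [ - (c * s) ] ⋆ (Q.δ i j ⋆ [ c * t ]))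
          ≈⟨ Q.∑-cong (λ c → Q.trans (Q.*-congˡ (Q.*-comm _ _)) (Q.sym (Q.*-assoc _ _ (Q.δ i j)))) ⟩
        Q.∑ (λ c → [ - (c * s) ] ⋆ [ c * t ] ⋆ Q.δ i j)
          ≈⟨ Q.∑-* (Q.δ i j) _ ⟨
        Q.∑ (λ c → [ - (c * s) ] ⋆ [ c * t ]) ⋆ Q.δ i j
          ≈⟨ Q.*-congʳ (orthogonality s t) ⟩
        ι (ℤ.+ q) ⋆ Q.δ s t ⋆ Q.δ i j
          ≈⟨ Q.*-assoc _ _ _ ⟩
        ι (ℤ.+ q) ⋆ (Q.δ s t ⋆ Q.δ i j)
          ≈⟨ Q.*-congˡ (Q.δ-combine s t i j) ⟨
        ι (ℤ.+ q) ⋆ Q.δ (combine {q} {m} s i) (combine {q} {m} t j) ∎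

      TM≈BT : T Q.⊗ M Q.≋ B Q.⊗ T
      TM≈BT = Q.≋-on-combine {q} {m} λ c x t y → begin
        (T Q.⊗ M) (combine c x) (combine t y)
          ≈⟨ Q.⊗-combine T M _ _ T-entry M-entry c x t y ⟩
        Q.∑ (λ s → Q.∑ λ i → Q.δ x i ⋆ [ c * s ] ⋆ ι (β i y (s - t)))
          ≈⟨ Q.∑-cong (λ s → Q.trans (Q.∑-cong λ i → Q.*-assoc (Q.δ x i) _ _) (Q.∑-δˡ x _)) ⟩
        Q.∑ (λ s → [ c * s ] ⋆ ι (β x y (s - t)))
          ≈⟨ []-⋆-∑ c t (β x y) ⟩
        push c (β x y) ⋆ [ c * t ]
          ≈⟨ Q.∑-δˡ c _ ⟨
        Q.∑ (λ d → Q.δ c d ⋆ (push c (β x y) ⋆ [ d * t ]))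
          ≈⟨ Q.∑-cong (λ d → Q.*-congˡ (Q.∑-δʳ y (λ i → push c (β x i) ⋆ [ d * t ]))) ⟨
        Q.∑ (λ d → Q.δ c d ⋆ Q.∑ λ i → push c (β x i) ⋆ [ d * t ] ⋆ Q.δ i y)
          ≈⟨ Q.∑-cong (λ d → Q.*-∑ (Q.δ c d) _) ⟩
        Q.∑ (λ d → Q.∑ λ i → Q.δ c d ⋆ (push c (β x i) ⋆ [ d * t ] ⋆ Q.δ i y))
          ≈⟨ Q.∑-cong (λ d → Q.∑-cong λ i → Q.trans
               (Q.*-congˡ (Q.trans (Q.*-assoc _ _ _) (Q.*-congˡ (Q.*-comm _ _)))) (Q.sym (Q.*-assoc _ _ _))) ⟩
        Q.∑ (λ d → Q.∑ λ i → Q.δ c d ⋆ push c (β x i) ⋆ (Q.δ i y ⋆ [ d * t ]))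
          ≈⟨ Q.⊗-combine B T _ _ (Q.blockDiagonal-entry λ c x y → push c (β x y)) T-entry c x t y ⟨
        (B Q.⊗ T) (combine c x) (combine t y) ∎

    -- `T` intertwines the group matrix with a block diagonal one, at the cost of one factor `q` per
    -- row; since `q` is a nonzero integer, this power cancels in the quotient.
    det-regular : ι (Z.det regular) ~ Q.∏ λ c → Q.det λ x y → push c (β x y)
    det-regular = begin
      ι (Z.det regular)    ≈⟨ DeterminantHomomorphism.det-homo ι-homomorphismQ regular ⟩
      Q.det M              ≈⟨ ι-^-cancel (ℤ.+ q) m×m (Q.det-intertwine S T M B ST≈q TM≈BT) ⟩
      Q.det B              ≈⟨ Q.det-blockDiagonal (λ c x y → push c (β x y)) ⟩
      Q.∏ (λ c → Q.det λ x y → push c (β x y)) ∎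

  scale : Fin N → Permutation q q
  scale i = Perm.permutation (suc i *_) (v *_) (cancel {v} {suc i} uv≡1) (cancel {suc i} {v} vu≡1)
    where
    v = proj₁ (inverse i)
    vu≡1 = proj₂ (inverse i)
    uv≡1 : suc i * v ≡ 1#
    uv≡1 = trans (F.*-comm (suc i) v) vu≡1

  unit : Fin N → Permutation N N
  unit i = Perm.remove zero (scale i)

  -- `remove` deletes `zero` and its image `suc i * zero`. Because that image is again `zero`, the
  -- remaining indices still name units through `suc`.
  suc-unit : ∀ i j → suc (unit i ⟨$⟩ʳ j) ≡ suc i * suc j
  suc-unit i j = trans
    (cong (λ z → punchIn z (unit i ⟨$⟩ʳ j)) (sym (F.zeroʳ (suc i))))
    (sym (Perm.punchIn-permute (scale i) zero j))

  push-scale : ∀ i f r → push (suc i) f (suc i * r) ≡ f r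
  push-scale i f r = trans
    (Z.∑-cong λ t → cong (f t ℤ.*_) (Z.δ-⇔ {i = suc i * t} {suc i * r} {t} {r} (λ eq →
      trans (sym (cancel (proj₂ (inverse i)) t)) (trans (cong (proj₁ (inverse i) *_) eq) (cancel (proj₂ (inverse i)) r)))
      (cong (suc i *_))))
    (Z.∑-δʳ r f)

  push-zero : ∀ f → push zero f ≗ ι (Z.∑ f)
  push-zero f s = trans
    (Z.∑-cong λ t → cong (λ z → f t ℤ.* Z.δ z s) (F.zeroˡ t))
    (sym (Z.∑-* (Z.δ zero s) f))

  ∏-ι : ∀ {n} (f : Fin n → Element) b → (∀ i → f i ~ ι b) → Q.∏ f ~ ι (b ℤ.^ n)
  ∏-ι {zero}  f b f~ = Q.refl
  ∏-ι {suc n} f b f~ = Q.trans (Q.*-cong (f~ zero) (∏-ι (f ∘ suc) b (f~ ∘ suc)))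
    (Q.sym (IsRingHomomorphism.*-homo ι-homomorphismQ b (b ℤ.^ n)))

  -- In GA(1,q) the block entry belongs to the group element with entries x/y and xs. Replacing x, y
  -- by ux, uy, or s by us, leads to the same element.
  record Equivariant (β : Fin N → Fin N → Element) : Set where
    field
      equivariance : ∀ i x y s → β (unit i ⟨$⟩ʳ x) (unit i ⟨$⟩ʳ y) s ≡ β x y (suc i * s)

  module Factors {β : Fin N → Fin N → Element} (equivariant : Equivariant β) where
    open Equivariant equivariant

    A : ℤ
    A = Z.det λ x y → Z.∑ (β x y)

    C : Element
    C = R.det β

    B : ℤ
    B = C zero ℤ.- C 1#

    det-push-zero : R.det (λ x y → push zero (β x y)) ≗ ι A
    det-push-zero = R.trans (R.det-cong λ x y → push-zero (β x y))
      (R.sym (DeterminantHomomorphism.det-homo ι-homomorphism (λ x y → Z.∑ (β x y))))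

    -- push (suc i) only permutes the rows and columns of an equivariant β.
    det-push-suc : ∀ i → R.det (λ x y → push (suc i) (β x y)) ≗ C
    det-push-suc i = R.trans
      (R.sym (R.det-permute (λ x y → push (suc i) (β x y)) (unit i)))
      (R.det-cong λ x y s → ≡.subst (λ s → push (suc i) (β (unit i ⟨$⟩ʳ x) (unit i ⟨$⟩ʳ y)) s ≡ β x y s)
        (Perm.inverseʳ (scale i))
        (trans (push-scale i (β (unit i ⟨$⟩ʳ x) (unit i ⟨$⟩ʳ y)) (scale i ⟨$⟩ˡ s)) (equivariance i x y _)))

    C-push : ∀ c → push c C ≗ R.det λ x y → push c (β x y)
    C-push c = DeterminantHomomorphism.det-homo (push-homomorphism c) β

    -- `C` is fixed by `push (suc i)`, which carries the coefficient at `1#` to `suc i`; the units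
    -- act transitively on the nonzero elements.
    C-suc : ∀ i → C (suc i) ≡ C 1#
    C-suc i = begin
      C (suc i)                      ≡⟨ det-push-suc i (suc i) ⟨
      _                              ≡⟨ C-push (suc i) (suc i) ⟨
      push (suc i) C (suc i)         ≡⟨ cong (push (suc i) C) (F.*-identityʳ (suc i)) ⟨
      push (suc i) C (suc i * 1#)    ≡⟨ push-scale i C 1# ⟩
      C 1#                           ∎
      where open ≡.≡-Reasoning

    C~ιB : C ~ ι B
    C~ιB = up-to (C 1#) λ
      { zero    → sym (trans (cong (ℤ._+ C 1#) (ℤ.*-identityʳ B)) (lemma (C zero) (C 1#)))
      ; (suc i) → trans (C-suc i) (sym (trans (cong (ℤ._+ C 1#) (ℤ.*-zeroʳ B)) (ℤ.+-identityˡ _)))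
      }
      where
      lemma : ∀ x y → x ℤ.- y ℤ.+ y ≡ x
      lemma = solve-∀

    det-regular≡AB^N : 1# ≢ zero → Z.det (regular β) ≡ A ℤ.* B ℤ.^ N
    det-regular≡AB^N 1≢0 = ι-injective 1≢0 (begin
      ι (Z.det (regular β))
        ≈⟨ det-regular β ⟩
      Q.det (λ x y → push zero (β x y)) ⋆ Q.∏ (λ i → Q.det λ x y → push (suc i) (β x y))
        ≈⟨ Q.*-cong
             (Q.trans (quotient-det _) (≗⇒~ det-push-zero))
             (∏-ι _ B λ i → Q.trans (quotient-det _) (Q.trans (≗⇒~ (det-push-suc i)) C~ιB)) ⟩
      ι A ⋆ ι (B ℤ.^ N)
        ≈⟨ IsRingHomomorphism.*-homo ι-homomorphismQ A (B ℤ.^ N) ⟨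
      ι (A ℤ.* B ℤ.^ N) ∎)
      where
      open ≈-Reasoning Q.setoid
      quotient-det : (M : Fin N → Fin N → Element) → Q.det M ~ R.det M
      quotient-det M = Q.sym (DeterminantHomomorphism.det-homo quotient-homomorphism M)

    -- `push zero` applied to `C` is computed twice: entrywise under the determinant it gives `A`,
    -- directly it gives the augmentation of `C`.
    A≡∑C : A ≡ C zero ℤ.+ ℤ.+ N ℤ.* C 1#
    A≡∑C = begin
      A                                           ≡⟨ ℤ.*-identityʳ A ⟨
      ι A zero                                    ≡⟨ det-push-zero zero ⟨
      _                                           ≡⟨ C-push zero zero ⟨
      push zero C zero                            ≡⟨ push-zero C zero ⟩
      Z.∑ C ℤ.* 1ℤ                                ≡⟨ ℤ.*-identityʳ _ ⟩
      Z.∑ C                                       ≡⟨ Z.∑-suc C ⟩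
      C zero ℤ.+ Z.∑ (C ∘ suc)                    ≡⟨ cong (λ x → C zero ℤ.+ x) (Z.∑-cong C-suc) ⟩
      C zero ℤ.+ Z.∑ {N} (λ _ → C 1#)             ≡⟨ cong (λ x → C zero ℤ.+ x) (∑-const N (C 1#)) ⟩
      C zero ℤ.+ ℤ.+ N ℤ.* C 1#                   ∎
      where open ≡.≡-Reasoning

    B-A : B ℤ.- A ≡ ℤ.- C 1# ℤ.* ℤ.+ q
    B-A = trans (cong (λ x → B ℤ.- x) A≡∑C) (lemma (C zero) (C 1#) (ℤ.+ N))
      where
      lemma : ∀ x y n → x ℤ.- y ℤ.- (x ℤ.+ n ℤ.* y) ≡ ℤ.- y ℤ.* (1ℤ ℤ.+ n)
      lemma = solve-∀

-- Primitive roots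

open import Data.List.Base using ([]; _∷_)
open import Data.List.Relation.Unary.All using (_∷_)
open import Data.Vec.Base using (Vec; []; _∷_; replicate)

-- Pigeonhole: if a value `j` were missed, punching it out would inject `Fin (suc n)` into `Fin n`.
injective⇒permutation : ∀ {n} (f : Fin n → Fin n) → Injective _≡_ _≡_ f →
                        Σ[ π ∈ Permutation n n ] ∀ i → π ⟨$⟩ʳ i ≡ f i
injective⇒permutation f f-inj =
  Perm.permutation f (proj₁ ∘ preimage f f-inj) (proj₂ ∘ preimage f f-inj)
    (λ i → f-inj (proj₂ (preimage f f-inj (f i))))
  , λ _ → refl
  where
  preimage : ∀ {n} (f : Fin n → Fin n) → Injective _≡_ _≡_ f → ∀ j → ∃[ i ] f i ≡ j
  preimage {suc n} f f-inj j with Fin.any? (λ i → f i Fin.≟ j)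
  ... | yes found = found
  ... | no ¬found = contradiction
    (Fin.injective⇒≤ {f = λ i → punchOut (λ eq → ¬found (i , sym eq))}
      (λ eq → f-inj (Fin.punchOut-injective (λ eq → ¬found (_ , sym eq)) (λ eq → ¬found (_ , sym eq)) eq)))
    ℕ.1+n≰n

prime-divisor : ∀ {n} → 1 < n → ∃[ r ] Prime r × r ∣ n
prime-divisor {n} 1<n with factorise n {{ℕ.>-nonZero (ℕ.<⇒≤ 1<n)}}
... | record { factors = [] ; isFactorisation = n≡1 } = contradiction n≡1 (ℕ.>⇒≢ 1<n)
... | record { factors = r ∷ rs ; isFactorisation = n≡ ; factorsPrime = r-prime ∷ _ } =
  r , r-prime , divides (product rs) (trans n≡ (ℕ.*-comm r (product rs)))

split-prime-power : ∀ {r} → Prime r → ∀ n → 1 ≤ n → ∃₂ λ e m → n ≡ r ℕ.^ e ℕ.* m × ¬ r ∣ m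
split-prime-power {r} r-prime = <-rec _ λ n rec 1≤n → case n rec 1≤n
  where
  instance
    _ = prime⇒nonTrivial r-prime
  case : ∀ n → (∀ {n′} → n′ < n → 1 ≤ n′ → ∃₂ λ e m → n′ ≡ r ℕ.^ e ℕ.* m × ¬ r ∣ m) →
         1 ≤ n → ∃₂ λ e m → n ≡ r ℕ.^ e ℕ.* m × ¬ r ∣ m
  case n rec 1≤n with r ∣? n
  ... | no r∤n = 0 , n , sym (ℕ.*-identityˡ n) , r∤n
  ... | yes (divides zero refl) = contradiction 1≤n λ ()
  ... | yes (divides n′@(suc _) refl) with rec (ℕ.m<m*n n′ r (ℕ.nonTrivial⇒n>1 r)) (s≤s z≤n)
  ...   | e , m , n′≡ , r∤m = suc e , m , (begin
            n′ ℕ.* r                ≡⟨ ℕ.*-comm n′ r ⟩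
            r ℕ.* n′                ≡⟨ cong (r ℕ.*_) n′≡ ⟩
            r ℕ.* (r ℕ.^ e ℕ.* m)   ≡⟨ ℕ.*-assoc r _ m ⟨
            r ℕ.^ suc e ℕ.* m       ∎) , r∤m
    where open ≡.≡-Reasoning

prime∤⇒coprime : ∀ {r n} → Prime r → ¬ r ∣ n → Coprime r n
prime∤⇒coprime r-prime r∤n (d∣r , d∣n) with prime⇒irreducible r-prime d∣r
... | inj₁ d≡1 = d≡1
... | inj₂ refl = contradiction d∣n r∤n

coprime-^ : ∀ {r n} → Coprime r n → ∀ e → Coprime (r ℕ.^ e) n
coprime-^ r⊥n zero    (d∣1 , _) = ℕ∣.∣1⇒≡1 d∣1
coprime-^ r⊥n (suc e) (d∣ , d∣n) = coprime-^ r⊥n e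
  (coprime-divisor (λ (k∣d , k∣r) → r⊥n (k∣r , ℕ∣.∣-trans k∣d d∣n)) d∣ , d∣n)

-- Multiplicative orders

module Orders {c ℓ} (S : CommutativeSemiring c ℓ) where
  open CommutativeSemiring S using (Carrier; _≈_; _*_; 1#; *-cong; *-congˡ; *-congʳ; *-identityˡ; *-identityʳ)
  open CommutativeSemiring S using () renaming (refl to ≈-refl; sym to ≈-sym; trans to ≈-trans)
  open import Algebra.Properties.CommutativeSemiring.Exp S

  1^n≈1 : ∀ n → 1# ^ n ≈ 1#
  1^n≈1 zero    = ≈-refl
  1^n≈1 (suc n) = ≈-trans (*-identityˡ _) (1^n≈1 n)

  ^-multiple : ∀ x m → x ^ m ≈ 1# → ∀ {n} → m ∣ n → x ^ n ≈ 1#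
  ^-multiple x m xᵐ≈1 (divides k refl) = ≈-trans (^-congʳ x (ℕ.*-comm k m))
    (≈-trans (≈-sym (^-assocʳ x m k)) (≈-trans (^-congˡ k xᵐ≈1) (1^n≈1 k)))

  -- Bézout over ℕ reads 1 + bn = am, or the same with the roles exchanged. Hence x = x · x^(bn) =
  -- x^(am) = 1, without any inverse.
  ^-coprime : ∀ {x m n} → Coprime m n → x ^ m ≈ 1# → x ^ n ≈ 1# → x ≈ 1#
  ^-coprime {x} {m} {n} m⊥n xᵐ≈1 xⁿ≈1 with coprime-Bézout m⊥n
  ... | Bézout.+- a b eq = ≈-trans (≈-sym (*-identityʳ x)) (≈-trans
    (*-congˡ (≈-sym (^-multiple x n xⁿ≈1 (divides b refl))))
    (≈-trans (^-congʳ x eq) (^-multiple x m xᵐ≈1 (divides a refl))))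
  ... | Bézout.-+ a b eq = ≈-trans (≈-sym (*-identityʳ x)) (≈-trans
    (*-congˡ (≈-sym (^-multiple x m xᵐ≈1 (divides a refl))))
    (≈-trans (^-congʳ x eq) (^-multiple x n xⁿ≈1 (divides b refl))))

  record HasMultiplicativeOrder (x : Carrier) (d : ℕ) : Set ℓ where
    field
      power   : x ^ d ≈ 1#
      minimal : ∀ i → x ^ i ≈ 1# → d ∣ i

  -- Induction on `e` through y^r: if y^i = 1, the order of y^r gives i = k r^(e+1) at the next
  -- stage. Then y^(r^(e+1)) has order r and k-th power 1, whence r divides k.
  prime-power-order : ∀ {r} → Prime r → ∀ e {y} → y ^ (r ℕ.^ suc e) ≈ 1# → ¬ y ^ (r ℕ.^ e) ≈ 1# →
                      HasMultiplicativeOrder y (r ℕ.^ suc e)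
  prime-power-order {r} r-prime e y^≈1 y^≉1 = record { power = y^≈1 ; minimal = minimal e y^≈1 y^≉1 }
    where
    prime-order : ∀ {w} → w ^ r ≈ 1# → ¬ w ≈ 1# → ∀ k → w ^ k ≈ 1# → r ∣ k
    prime-order wʳ≈1 w≉1 k wᵏ≈1 with r ∣? k
    ... | yes r∣k = r∣k
    ... | no r∤k = contradiction (^-coprime (prime∤⇒coprime r-prime r∤k) wʳ≈1 wᵏ≈1) w≉1

    minimal : ∀ e {y} → y ^ (r ℕ.^ suc e) ≈ 1# → ¬ y ^ (r ℕ.^ e) ≈ 1# →
              ∀ i → y ^ i ≈ 1# → r ℕ.^ suc e ∣ i
    minimal zero {y} y^≈1 y^≉1 i yⁱ≈1 = subst (_∣ i) (sym (ℕ.*-identityʳ r))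
      (prime-order (≈-trans (^-congʳ y (sym (ℕ.*-identityʳ r))) y^≈1)
        (y^≉1 ∘ ≈-trans (*-identityʳ y)) i yⁱ≈1)
    minimal (suc e) {y} y^≈1 y^≉1 i yⁱ≈1
      with minimal e {y ^ r} (≈-trans (^-assocʳ y r _) y^≈1) (y^≉1 ∘ ≈-trans (≈-sym (^-assocʳ y r _)))
             i (≈-trans (^-assocʳ y r i) (^-multiple y i yⁱ≈1 (ℕ∣.n∣m*n r)))
    ... | divides k refl = ℕ∣.*-monoˡ-∣ (r ℕ.^ suc e) (prime-order {y ^ (r ℕ.^ suc e)}
      (≈-trans (^-assocʳ y (r ℕ.^ suc e) r) (≈-trans (^-congʳ y (ℕ.*-comm (r ℕ.^ suc e) r)) y^≈1)) y^≉1 k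
      (≈-trans (^-assocʳ y (r ℕ.^ suc e) k) (≈-trans (^-congʳ y (ℕ.*-comm (r ℕ.^ suc e) k)) yⁱ≈1)))

  -- Raising (xy)^i = 1 to the n-th power removes y and yields m | ni, so m | i by coprimality; the
  -- m-th power removes x in the same way.
  coprime-order : ∀ {x y m n} → Coprime m n → HasMultiplicativeOrder x m → HasMultiplicativeOrder y n →
                  HasMultiplicativeOrder (x * y) (m ℕ.* n)
  coprime-order {x} {y} {m} {n} m⊥n x-order y-order = record
    { power = ≈-trans (^-distrib-* x y (m ℕ.* n)) (≈-trans
        (*-cong (^-multiple x m x.power (ℕ∣.m∣m*n n)) (^-multiple y n y.power (ℕ∣.n∣m*n m))) (*-identityˡ 1#))
    ; minimal = minimal
    }
    where
    module x = HasMultiplicativeOrder x-order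
    module y = HasMultiplicativeOrder y-order
    raise : ∀ i k → (x * y) ^ i ≈ 1# → x ^ (k ℕ.* i) * y ^ (k ℕ.* i) ≈ 1#
    raise i k eq = ≈-trans (≈-sym (^-distrib-* x y (k ℕ.* i))) (^-multiple (x * y) i eq (ℕ∣.n∣m*n k))

    minimal : ∀ i → (x * y) ^ i ≈ 1# → m ℕ.* n ∣ i
    minimal i eq with coprime-divisor {m} {n} m⊥n (x.minimal (n ℕ.* i) (≈-trans
      (≈-trans (≈-sym (*-identityʳ _)) (*-congˡ (≈-sym (^-multiple y n y.power (ℕ∣.m∣m*n i))))) (raise i n eq)))
    ... | divides k refl = subst (_∣ k ℕ.* m) (ℕ.*-comm n m) (ℕ∣.*-monoˡ-∣ m
      (coprime-divisor {n} {m} (Coprimality.sym m⊥n) (subst (n ∣_) (ℕ.*-comm k m) n∣km)))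
      where
      n∣km : n ∣ k ℕ.* m
      n∣km = coprime-divisor {n} {m} (Coprimality.sym m⊥n) (y.minimal (m ℕ.* (k ℕ.* m)) (≈-trans
        (≈-trans (≈-sym (*-identityˡ _)) (*-congʳ (≈-sym (^-multiple x m x.power (ℕ∣.m∣m*n (k ℕ.* m))))))
        (raise (k ℕ.* m) m eq)))

-- Cyclicity of F*

module CyclicUnits
  {N : ℕ} {add mul : Fin (suc N) → Fin (suc N) → Fin (suc N)} {neg : Fin (suc N) → Fin (suc N)}
  {1# : Fin (suc N)} (isCommutativeRing : IsCommutativeRing _≡_ add mul neg zero 1#)
  (inverse : ∀ i → ∃[ y ] mul y (suc i) ≡ 1#) (1≢0 : 1# ≢ zero) where

  open FiniteField isCommutativeRing inverse
  open F using (_+_; _*_; -_; _-_)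
  open import Algebra.Properties.CommutativeSemiring.Exp F.commutativeSemiring
  open import Algebra.Solver.Ring.NaturalCoefficients.Default F.commutativeSemiring
    using (solve; _:=_; _:+_; _:*_)
  open Orders F.commutativeSemiring
  private
    module Π = CommutativeMonoidSum F.*-commutativeMonoid

  *-cancelˡ-nonzero : ∀ {u x y} → u ≢ zero → u * x ≡ u * y → x ≡ y
  *-cancelˡ-nonzero {u} {x} {y} u≢0 eq = let v , vu≡1 = nonzero-inverse u≢0 in
    trans (sym (cancel {u} {v} vu≡1 x)) (trans (cong (v *_) eq) (cancel {u} {v} vu≡1 y))

  *-nonzero : ∀ {x y} → x ≢ zero → y ≢ zero → x * y ≢ zero
  *-nonzero {x} x≢0 y≢0 xy≡0 = y≢0 (*-cancelˡ-nonzero x≢0 (trans xy≡0 (sym (F.zeroʳ x))))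

  -- Multiplying every unit by `suc i` only permutes the factors of the product of all units, and
  -- this product is nonzero, so it cancels.
  fermat : ∀ i → suc i ^ N ≡ 1#
  fermat i = *-cancelˡ-nonzero (∏≢0 suc λ _ ()) (begin
    P * suc i ^ N
      ≡⟨ F.*-comm P _ ⟩
    suc i ^ N * P
      ≡⟨ cong (_* P) (Π.sum-replicate N) ⟨
    Π.sum {N} (λ _ → suc i) * P
      ≡⟨ Π.∑-distrib-+ {N} (λ _ → suc i) suc ⟨
    Π.sum {N} (λ j → suc i * suc j)
      ≡⟨ Π.sum-cong-≗ (λ j → sym (suc-unit i j)) ⟩
    Π.sum {N} (λ j → suc (unit i ⟨$⟩ʳ j))
      ≡⟨ Π.sum-permute suc (unit i) ⟨
    P
      ≡⟨ F.*-identityʳ P ⟨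
    P * 1# ∎)
    where
    open ≡.≡-Reasoning
    P = Π.sum {N} suc
    ∏≢0 : ∀ {n} (f : Fin n → Fin q) → (∀ i → f i ≢ zero) → Π.sum f ≢ zero
    ∏≢0 {zero}  f f≢0 = 1≢0
    ∏≢0 {suc n} f f≢0 = *-nonzero (f≢0 zero) (∏≢0 (f ∘ suc) (f≢0 ∘ suc))

  -- The Horner scheme of the monic polynomial with the given lower coefficients.
  evaluate : ∀ {d} → Vec (Fin q) d → Fin q → Fin q
  evaluate []       x = 1#
  evaluate (a ∷ as) x = a + x * evaluate as x

  -- Synthetic division by X - r: the coefficients of the quotient are the Horner values at `r` of
  -- the successive tails, its leading 1 being implicit.
  divide : ∀ {d} → Fin q → Vec (Fin q) (suc d) → Vec (Fin q) d
  divide r (a ∷ [])         = []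
  divide r (a ∷ as@(_ ∷ _)) = evaluate as r ∷ divide r as

  -- The remainder identity P(x) = P(r) + (x - r) Q(x), written with x = r + h to avoid subtraction
  -- and remain an identity of semirings.
  evaluate-divide : ∀ {d} r (as : Vec (Fin q) (suc d)) h →
    evaluate as (r + h) ≡ evaluate as r + h * evaluate (divide r as) (r + h)
  evaluate-divide r (a ∷ []) h =
    trans (cong (a +_) (F.distribʳ 1# r h)) (sym (F.+-assoc a _ _))
  evaluate-divide r (a ∷ as@(_ ∷ _)) h = begin
    a + (r + h) * evaluate as (r + h)
      ≡⟨ cong (λ x → a + (r + h) * x) (evaluate-divide r as h) ⟩
    a + (r + h) * (P + h * Q)
      ≡⟨ solve 5 (λ a r h P Q → a :+ (r :+ h) :* (P :+ h :* Q)
                             := (a :+ r :* P) :+ h :* (P :+ (r :+ h) :* Q)) refl a r h P Q ⟩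
    (a + r * P) + h * (P + (r + h) * Q) ∎
    where
    open ≡.≡-Reasoning
    P = evaluate as r
    Q = evaluate (divide r as) (r + h)

  root-bound : ∀ {d n} (as : Vec (Fin q) d) (xs : Fin n → Fin q) → Injective _≡_ _≡_ xs →
               (∀ i → evaluate as (xs i) ≡ zero) → n ≤ d
  root-bound {n = zero}  as xs xs-inj roots = z≤n
  root-bound {n = suc n} [] xs xs-inj roots = contradiction (roots zero) 1≢0
  root-bound {n = suc n} as@(_ ∷ _) xs xs-inj roots =
    s≤s (root-bound (divide r as) (xs ∘ suc) (Fin.suc-injective ∘ xs-inj) root)
    where
    open ≡.≡-Reasoning
    r = xs zero
    root : ∀ i → evaluate (divide r as) (xs (suc i)) ≡ zero
    root i = *-cancelˡ-nonzero h≢0 (begin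
      h * evaluate (divide r as) x           ≡⟨ F.+-identityˡ _ ⟨
      zero + h * evaluate (divide r as) x    ≡⟨ cong₂ (λ u v → u + h * evaluate (divide r as) v)
                                                      (sym (roots zero)) (sym r+h≡x) ⟩
      evaluate as r + h * evaluate (divide r as) (r + h) ≡⟨ evaluate-divide r as h ⟨
      evaluate as (r + h)                    ≡⟨ cong (evaluate as) r+h≡x ⟩
      evaluate as x                          ≡⟨ roots (suc i) ⟩
      zero                                   ≡⟨ F.zeroʳ h ⟨
      h * zero                               ∎)
      where
      x = xs (suc i)
      h = x - r
      r+h≡x : r + h ≡ x
      r+h≡x = trans (F.+-comm r h) (sub-add x r)
      h≢0 : h ≢ zero
      h≢0 h≡0 = contradiction (xs-inj (trans (sym r+h≡x) (trans (cong (r +_) h≡0) (F.+-identityʳ r)))) λ ()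

  power-bound : ∀ k → (∀ i → suc i ^ suc k ≡ 1#) → N ≤ suc k
  -- The coefficients are those of X^(k+1) - 1, of which all N units are roots.
  power-bound k powers = root-bound (- 1# ∷ replicate k zero) suc Fin.suc-injective λ i → begin
    - 1# + suc i * evaluate (replicate k zero) (suc i)  ≡⟨ cong (λ x → - 1# + suc i * x) (evaluate-zeros k (suc i)) ⟩
    - 1# + suc i ^ suc k                                ≡⟨ cong (- 1# +_) (powers i) ⟩
    - 1# + 1#                                           ≡⟨ F.-‿inverseˡ 1# ⟩
    zero                                                ∎
    where
    open ≡.≡-Reasoning
    evaluate-zeros : ∀ k x → evaluate (replicate k zero) x ≡ x ^ k
    evaluate-zeros zero    x = refl
    evaluate-zeros (suc k) x = trans (F.+-identityˡ _) (cong (x *_) (evaluate-zeros k x))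

  non-root : ∀ k → suc k < N → ∃[ i ] suc i ^ suc k ≢ 1#
  non-root k k<N = Fin.¬∀⟶∃¬ N _ (λ i → suc i ^ suc k Fin.≟ 1#) λ powers →
    ℕ.<⇒≱ k<N (power-bound k powers)

  -- Put n = N/r and m = N/r^(e+1). As n < N, some unit x has xⁿ ≠ 1, and y = x^m works: its
  -- r^(e+1)-th power is x^N = 1, its r^e-th power is xⁿ. In `result` the number n is a variable, so
  -- that it can be matched as a successor.
  element-of-prime-power-order : ∀ {r} → Prime r → ∀ e → r ℕ.^ suc e ∣ N → 1 ≤ N →
                                 ∃[ y ] HasMultiplicativeOrder y (r ℕ.^ suc e)
  element-of-prime-power-order {r} r-prime e (divides m N≡) 1≤N = result (r ℕ.^ e ℕ.* m) refl
    where
    instance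
      _ = prime⇒nonTrivial r-prime
    open ≡.≡-Reasoning
    r*n≡N : r ℕ.* (r ℕ.^ e ℕ.* m) ≡ N
    r*n≡N = trans (sym (ℕ.*-assoc r _ m)) (trans (ℕ.*-comm _ m) (sym N≡))

    result : ∀ n → n ≡ r ℕ.^ e ℕ.* m → ∃[ y ] HasMultiplicativeOrder y (r ℕ.^ suc e)
    result zero    n≡ = contradiction (trans (sym r*n≡N) (trans (cong (r ℕ.*_) (sym n≡)) (ℕ.*-zeroʳ r))) (ℕ.m<n⇒n≢0 1≤N)
    result (suc n) n≡ with non-root n (subst (suc n <_) (trans (cong (r ℕ.*_) n≡) r*n≡N)
                         (subst (suc n <_) (ℕ.*-comm (suc n) r) (ℕ.m<m*n (suc n) r (ℕ.nonTrivial⇒n>1 r))))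
    ... | i , power≢1 = suc i ^ m , prime-power-order r-prime e
      (trans (^-assocʳ (suc i) m _) (trans (cong (suc i ^_) (sym N≡)) (fermat i)))
      (λ eq → power≢1 (trans (cong (suc i ^_) (trans n≡ (ℕ.*-comm (r ℕ.^ e) m)))
                               (trans (sym (^-assocʳ (suc i) m (r ℕ.^ e))) eq)))

  -- Strong induction on `d`: the full power of one prime divisor is split off, and elements of the
  -- two coprime orders are multiplied. At d = N this yields a generator.
  element-of-order : ∀ d → 1 ≤ N → d ∣ N → ∃[ y ] HasMultiplicativeOrder y d
  element-of-order d 1≤N = <-rec (λ d → d ∣ N → ∃[ y ] HasMultiplicativeOrder y d) step d
    where
    step : ∀ d → (∀ {d′} → d′ < d → d′ ∣ N → ∃[ y ] HasMultiplicativeOrder y d′) → d ∣ N → ∃[ y ] HasMultiplicativeOrder y d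
    step zero rec 0∣N = contradiction (ℕ∣.0∣⇒≡0 0∣N) (ℕ.m<n⇒n≢0 1≤N)
    step (suc zero) rec 1∣N = 1# , record { power = F.*-identityˡ 1# ; minimal = λ i _ → ℕ∣.1∣ i }
    step d@(suc (suc _)) rec d∣N with prime-divisor {d} (s≤s (s≤s z≤n))
    ... | r , r-prime , r∣d with split-prime-power r-prime d (s≤s z≤n)
    ...   | zero , m , d≡ , r∤m = contradiction (subst (r ∣_) (trans d≡ (ℕ.*-identityˡ m)) r∣d) r∤m
    ...   | suc e , m , d≡ , r∤m = y * z , subst (HasMultiplicativeOrder (y * z)) (sym d≡)
              (coprime-order (coprime-^ (prime∤⇒coprime r-prime r∤m) (suc e)) y-order z-order)
      where
      m∣d : m ∣ d
      m∣d = divides (r ℕ.^ suc e) d≡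
      m<d : m < d
      m<d = ℕ.≤∧≢⇒< (ℕ∣.∣⇒≤ m∣d) λ { refl → r∤m r∣d }
      y-exists = element-of-prime-power-order r-prime e
        (ℕ∣.∣-trans (divides m (trans d≡ (ℕ.*-comm _ m))) d∣N) 1≤N
      y = proj₁ y-exists
      y-order = proj₂ y-exists
      z-exists = rec m<d (ℕ∣.∣-trans m∣d d∣N)
      z = proj₁ z-exists
      z-order = proj₂ z-exists

  -- `exp` is the discrete exponential, a bijection from exponents below N to indices of units.
  record PrimitiveRoot : Set where
    field
      g         : Fin q
      exp       : Permutation N N
      exp-power : ∀ i → suc (exp ⟨$⟩ʳ i) ≡ g ^ toℕ i
      g^N≡1     : g ^ N ≡ 1#

  primitiveRoot : 1 ≤ N → PrimitiveRoot
  primitiveRoot 1≤N = record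
    { g = g
    ; exp = proj₁ permutation
    ; exp-power = λ i → trans (cong suc (proj₂ permutation i)) (suc-power-index i)
    ; g^N≡1 = power
    }
    where
    g-exists = element-of-order N 1≤N ℕ∣.∣-refl
    g = proj₁ g-exists
    open HasMultiplicativeOrder (proj₂ g-exists)

    ^-nonzero : ∀ n → n ≤ N → g ^ n ≢ zero
    ^-nonzero n n≤N gⁿ≡0 = 1≢0 (begin
      1#                       ≡⟨ power ⟨
      g ^ N                    ≡⟨ cong (g ^_) (ℕ.m+[n∸m]≡n n≤N) ⟨
      g ^ (n ℕ.+ (N ℕ.∸ n))    ≡⟨ ^-homo-* g n _ ⟩
      g ^ n * g ^ (N ℕ.∸ n)    ≡⟨ cong (_* g ^ (N ℕ.∸ n)) gⁿ≡0 ⟩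
      zero * g ^ (N ℕ.∸ n)     ≡⟨ F.zeroˡ _ ⟩
      zero                     ∎)
      where open ≡.≡-Reasoning

    power-index : Fin N → Fin N
    power-index i = punchOut (^-nonzero (toℕ i) (ℕ.<⇒≤ (Fin.toℕ<n i)) ∘ sym)

    suc-power-index : ∀ i → suc (power-index i) ≡ g ^ toℕ i
    suc-power-index i = Fin.punchIn-punchOut (^-nonzero (toℕ i) (ℕ.<⇒≤ (Fin.toℕ<n i)) ∘ sym)

    ^-injective : ∀ {i j} → i ≤ j → j < N → g ^ i ≡ g ^ j → i ≡ j
    ^-injective {i} {j} i≤j j<N gⁱ≡gʲ = ℕ.≤-antisym i≤j (ℕ.m∸n≡0⇒m≤n (small
      (minimal (j ℕ.∸ i) (*-cancelˡ-nonzero (^-nonzero i (ℕ.≤-trans i≤j (ℕ.<⇒≤ j<N))) (begin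
        g ^ i * g ^ (j ℕ.∸ i)    ≡⟨ ^-homo-* g i _ ⟨
        g ^ (i ℕ.+ (j ℕ.∸ i))    ≡⟨ cong (g ^_) (ℕ.m+[n∸m]≡n i≤j) ⟩
        g ^ j                    ≡⟨ gⁱ≡gʲ ⟨
        g ^ i                    ≡⟨ F.*-identityʳ _ ⟨
        g ^ i * 1#               ∎)))
      (ℕ.≤-<-trans (ℕ.m∸n≤m j i) j<N)))
      where
      open ≡.≡-Reasoning
      small : ∀ {k} → N ∣ k → k < N → k ≡ 0
      small {zero}  N∣k k<N = refl
      small {suc k} N∣k k<N = contradiction (ℕ∣.∣⇒≤ N∣k) (ℕ.<⇒≱ k<N)

    power-index-injective : Injective _≡_ _≡_ power-index
    power-index-injective {i} {j} eq with ℕ.≤-total (toℕ i) (toℕ j)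
    ... | inj₁ i≤j = Fin.toℕ-injective (^-injective i≤j (Fin.toℕ<n j) powers)
      where powers = trans (sym (suc-power-index i)) (trans (cong suc eq) (suc-power-index j))
    ... | inj₂ j≤i = Fin.toℕ-injective (sym (^-injective j≤i (Fin.toℕ<n i) powers))
      where powers = trans (sym (suc-power-index j)) (trans (cong suc (sym eq)) (suc-power-index i))

    permutation = injective⇒permutation power-index power-index-injective

-- Group determinants of ℤ/N and GA(1, q)

open import Defs
open import Data.Nat.Base using (_^_; _∸_)

det≡ : ∀ {n} (M : Fin n → Fin n → ℤ) → det M ≡ Z.det M
det≡ {zero}  M = sym (Z.det-empty M)
det≡ {suc n} M = sym (begin
  Z.det M
    ≡⟨ Z.det-suc M ⟩
  Z.∑ (λ j → Z.sgn (toℕ j) ℤ.* (M zero j ℤ.* Z.det (Z.minor M j)))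
    ≡⟨ Z.∑-cong (λ j → trans (sym (ℤ.*-assoc (Z.sgn (toℕ j)) (M zero j) _))
         (cong₂ (λ s d → s ℤ.* M zero j ℤ.* d) (sgn≡ (toℕ j)) (sym (det≡ (Z.minor M j))))) ⟩
  _
    ≡⟨ Z.∑-unfold _ ⟩
  det M ∎)
  where
  open ≡.≡-Reasoning
  sgn≡ : ∀ k → Z.sgn k ≡ ℤ.-1ℤ ℤ.^ k
  sgn≡ zero    = refl
  sgn≡ (suc k) = trans (cong ℤ.-_ (sgn≡ k)) (sym (ℤ.-1*i≡-i _))

module _ {c ℓ} (G : Group c ℓ) where
  private
    module G = Group G

  -- Two enumerations differ by a bijection of their index sets, which acts on rows and columns at
  -- once and hence without a sign.
  groupDeterminant-invariant : ∀ {m n} (g : Enumeration n G.setoid) (h : Enumeration m G.setoid)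
    (a : Coefficients G) → groupDeterminant G g a ≡ groupDeterminant G h a
  groupDeterminant-invariant {m} {n} g h a = begin
    det (λ i j → M (to g i) (to g j))                            ≡⟨ det≡ _ ⟩
    Z.det (λ i j → M (to g i) (to g j))                      ≡⟨ Z.det-permute _ π ⟨
    Z.det (λ i j → M (to g (π ⟨$⟩ʳ i)) (to g (π ⟨$⟩ʳ j)))    ≡⟨ Z.det-cong (λ i j →
                                                                     Func.cong a (G.∙-cong (back i) (G.⁻¹-cong (back j)))) ⟩
    Z.det (λ i j → M (to h i) (to h j))                      ≡⟨ det≡ _ ⟨
    det (λ i j → M (to h i) (to h j))                            ∎
    where
    open ≡.≡-Reasoning
    open Inverse using (to)
    M : G.Carrier → G.Carrier → ℤ
    M x y = Func.to a (x G.∙ y G.⁻¹)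
    π : Permutation m n
    π = Composition.inverse h (Symmetry.inverse g)
    back : ∀ i → to g (π ⟨$⟩ʳ i) G.≈ to h i
    back i = Inverse.strictlyInverseˡ g (to h i)

-- Residues modulo N

module Residues (N : ℕ) .{{_ : ℕ.NonZero N}} where
  open Group (ℤ/ N) using ()
    renaming (refl to ≈-refl; sym to ≈-sym; trans to ≈-trans; setoid to ℤ/-setoid)

  mod⇒∣∸ : ∀ {a b} → a ≤ b → ℤ.+ a ≡ ℤ.+ b [mod N ] → N ∣ b ∸ a
  mod⇒∣∸ {a} {b} a≤b a≡b = subst (N ∣_)
    (trans (cong ℤ.∣_∣ (ℤ.m-n≡m⊖n a b)) (ℤ.∣⊖∣-≤ a≤b)) (ℤ∣.∣⇒∣ᵤ a≡b)

  private
    residue-unique-≤ : ∀ {a b} → a ≤ b → b < N → ℤ.+ a ≡ ℤ.+ b [mod N ] → a ≡ b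
    residue-unique-≤ {a} {b} a≤b b<N a≡b with b ∸ a in eq | mod⇒∣∸ a≤b a≡b
    ... | zero  | _   = ℕ.≤-antisym a≤b (ℕ.m∸n≡0⇒m≤n eq)
    ... | suc k | N∣k = contradiction (ℕ∣.∣⇒≤ N∣k)
      (ℕ.<⇒≱ (subst (_< N) eq (ℕ.≤-<-trans (ℕ.m∸n≤m b a) b<N)))

  residue-unique : ∀ {a b} → a < N → b < N → ℤ.+ a ≡ ℤ.+ b [mod N ] → a ≡ b
  residue-unique {a} {b} a<N b<N a≡b with ℕ.≤-total a b
  ... | inj₁ a≤b = residue-unique-≤ a≤b b<N a≡b
  ... | inj₂ b≤a = sym (residue-unique-≤ b≤a a<N (≈-sym {ℤ.+ a} {ℤ.+ b} a≡b))

  residue : ℤ → Fin N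
  residue z = fromℕ< (ℤ.n%ℕd<d z N)

  residue≡ : ∀ z → ℤ.+ toℕ (residue z) ≡ z [mod N ]
  residue≡ z = subst (λ r → ℤ.+ r ≡ z [mod N ]) (sym (Fin.toℕ-fromℕ< (ℤ.n%ℕd<d z N)))
    (ℤ∣.divides (ℤ.- (z ℤ./ℕ N)) (begin
      r ℤ.- z                              ≡⟨ cong (λ x → r ℤ.- x) (ℤ.a≡a%ℕn+[a/ℕn]*n z N) ⟩
      r ℤ.- (r ℤ.+ (z ℤ./ℕ N) ℤ.* ℤ.+ N)   ≡⟨ lemma r (z ℤ./ℕ N) (ℤ.+ N) ⟩
      ℤ.- (z ℤ./ℕ N) ℤ.* ℤ.+ N             ∎))
    where
    open ≡.≡-Reasoning
    r = ℤ.+ (z ℤ.%ℕ N)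
    lemma : ∀ r x n → r ℤ.- (r ℤ.+ x ℤ.* n) ≡ ℤ.- x ℤ.* n
    lemma = solve-∀

  residue-cong : ∀ {z w} → z ≡ w [mod N ] → residue z ≡ residue w
  residue-cong {z} {w} z≡w = Fin.toℕ-injective (residue-unique (Fin.toℕ<n _) (Fin.toℕ<n _)
    (≈-trans {ℤ.+ toℕ (residue z)} {z} {ℤ.+ toℕ (residue w)} (residue≡ z)
      (≈-trans {z} {w} {ℤ.+ toℕ (residue w)} z≡w (≈-sym {ℤ.+ toℕ (residue w)} {w} (residue≡ w)))))

  residue-toℕ : ∀ i → residue (ℤ.+ toℕ i) ≡ i
  residue-toℕ i = Fin.toℕ-injective (residue-unique (Fin.toℕ<n _) (Fin.toℕ<n i) (residue≡ (ℤ.+ toℕ i)))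

  ℤ/-enumeration : Enumeration N ℤ/-setoid
  ℤ/-enumeration = record
    { to = λ i → ℤ.+ toℕ i
    ; from = residue
    ; to-cong = λ { {x = i} refl → ≈-refl {ℤ.+ toℕ i} }
    ; from-cong = λ {z} {w} → residue-cong {z} {w}
    ; inverse = (λ { {z} refl → residue≡ z })
              , (λ {i} {z} z≡i → trans (residue-cong {z} {ℤ.+ toℕ i} z≡i) (residue-toℕ i))
    }

module CyclicDeterminant
  {N : ℕ} {add mul : Fin (suc N) → Fin (suc N) → Fin (suc N)} {neg : Fin (suc N) → Fin (suc N)}
  {1# : Fin (suc N)} (isCommutativeRing : IsCommutativeRing _≡_ add mul neg zero 1#)
  (inverse : ∀ i → ∃[ y ] mul y (suc i) ≡ 1#) (1≢0 : 1# ≢ zero) where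

  open FiniteField isCommutativeRing inverse
  open F using (_+_; _*_; -_; _-_)
  open CyclicUnits isCommutativeRing inverse 1≢0
  open import Algebra.Properties.CommutativeSemiring.Exp F.commutativeSemiring using (^-homo-*) renaming (_^_ to _^′_)
  open Orders F.commutativeSemiring using (^-multiple)

  1≤N : 1 ≤ N
  1≤N = positive 1# 1≢0
    where
    positive : ∀ {N} (i : Fin (suc N)) → i ≢ zero → 1 ≤ N
    positive         zero    i≢0 = contradiction refl i≢0
    positive {suc N} (suc i) i≢0 = s≤s z≤n

  instance
    N≢0 : ℕ.NonZero N
    N≢0 = ℕ.>-nonZero 1≤N

  open Residues N
  open PrimitiveRoot (primitiveRoot 1≤N)

  private
    ^-mod-≤ : ∀ a b → a ≤ b → ℤ.+ a ≡ ℤ.+ b [mod N ] → g ^′ a ≡ g ^′ b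
    ^-mod-≤ a b a≤b a≡b = begin
      g ^′ a                     ≡⟨ F.*-identityʳ _ ⟨
      g ^′ a * 1#                ≡⟨ cong (g ^′ a *_) (^-multiple g N g^N≡1 (mod⇒∣∸ a≤b a≡b)) ⟨
      g ^′ a * g ^′ (b ∸ a)      ≡⟨ ^-homo-* g a (b ∸ a) ⟨
      g ^′ (a ℕ.+ (b ∸ a))       ≡⟨ cong (g ^′_) (ℕ.m+[n∸m]≡n a≤b) ⟩
      g ^′ b                     ∎
      where open ≡.≡-Reasoning

  ^-mod : ∀ a b → ℤ.+ a ≡ ℤ.+ b [mod N ] → g ^′ a ≡ g ^′ b
  ^-mod a b a≡b with ℕ.≤-total a b
  ... | inj₁ a≤b = ^-mod-≤ a b a≤b a≡b
  ... | inj₂ b≤a = sym (^-mod-≤ b a b≤a (Group.sym (ℤ/ N) {ℤ.+ a} {ℤ.+ b} a≡b))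

  -- This is g^j · g^(i-j) = g^i. The possibly negative exponent i - j is first reduced modulo N,
  -- since powers are taken with natural exponents.
  exp-difference : ∀ i j → unit (exp ⟨$⟩ʳ j) ⟨$⟩ʳ (exp ⟨$⟩ʳ residue (ℤ.+ toℕ i ℤ.- ℤ.+ toℕ j)) ≡ exp ⟨$⟩ʳ i
  exp-difference i j = Fin.suc-injective (begin
    suc (unit (exp ⟨$⟩ʳ j) ⟨$⟩ʳ (exp ⟨$⟩ʳ r))      ≡⟨ suc-unit (exp ⟨$⟩ʳ j) _ ⟩
    suc (exp ⟨$⟩ʳ j) * suc (exp ⟨$⟩ʳ r)            ≡⟨ cong₂ _*_ (exp-power j) (exp-power r) ⟩
    g ^′ toℕ j * g ^′ toℕ r                        ≡⟨ ^-homo-* g (toℕ j) (toℕ r) ⟨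
    g ^′ (toℕ j ℕ.+ toℕ r)                         ≡⟨ ^-mod (toℕ j ℕ.+ toℕ r) (toℕ i) j+r≡i ⟩
    g ^′ toℕ i                                     ≡⟨ exp-power i ⟨
    suc (exp ⟨$⟩ʳ i)                               ∎)
    where
    open ≡.≡-Reasoning
    r = residue (ℤ.+ toℕ i ℤ.- ℤ.+ toℕ j)
    lemma : ∀ r i j → r ℤ.- (i ℤ.- j) ≡ (j ℤ.+ r) ℤ.- i
    lemma = solve-∀
    j+r≡i : ℤ.+ (toℕ j ℕ.+ toℕ r) ≡ ℤ.+ toℕ i [mod N ]
    j+r≡i = subst (ℤ.+ N ℤ∣.∣_) (lemma (ℤ.+ toℕ r) (ℤ.+ toℕ i) (ℤ.+ toℕ j))
      (residue≡ (ℤ.+ toℕ i ℤ.- ℤ.+ toℕ j))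

  -- `N` is a variable known only to be nonzero, so the exponent 0 is written `residue 0ℤ`; its
  -- power of g is `1#`.
  exp-zero : ∀ j → unit (exp ⟨$⟩ʳ j) ⟨$⟩ʳ (exp ⟨$⟩ʳ residue 0ℤ) ≡ exp ⟨$⟩ʳ j
  exp-zero j = Fin.suc-injective (begin
    suc (unit (exp ⟨$⟩ʳ j) ⟨$⟩ʳ (exp ⟨$⟩ʳ residue 0ℤ))   ≡⟨ suc-unit (exp ⟨$⟩ʳ j) _ ⟩
    suc (exp ⟨$⟩ʳ j) * suc (exp ⟨$⟩ʳ residue 0ℤ)         ≡⟨ cong (suc (exp ⟨$⟩ʳ j) *_) (trans
                                                              (exp-power (residue 0ℤ))
                                                              (^-mod (toℕ (residue 0ℤ)) 0 (residue≡ 0ℤ))) ⟩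
    suc (exp ⟨$⟩ʳ j) * 1#                                ≡⟨ F.*-identityʳ _ ⟩
    suc (exp ⟨$⟩ʳ j)                                     ∎)
    where open ≡.≡-Reasoning

  module _ {β : Fin N → Fin N → Element} (equivariant : Equivariant β) where
    open Factors equivariant
    open Equivariant equivariant

    -- The augmentation of the block in row g^z and column 1. For GA(1,q) this sums the given
    -- coefficients over all group elements with linear part g^z.
    coefficients : Coefficients (ℤ/ N)
    coefficients = record
      { to = λ z → Z.∑ (β (exp ⟨$⟩ʳ residue z) (exp ⟨$⟩ʳ residue 0ℤ))
      ; cong = λ {z} {w} z≡w → cong (λ r → Z.∑ (β (exp ⟨$⟩ʳ r) (exp ⟨$⟩ʳ residue 0ℤ))) (residue-cong {z} {w} z≡w)
      }

    isCyclicDeterminant : IsIntegerGroupDeterminant (ℤ/ N) A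
    isCyclicDeterminant = N , ℤ/-enumeration , coefficients , sym (begin
      det {N} (λ i j → Func.to coefficients (ℤ.+ toℕ i ℤ.- ℤ.+ toℕ j))
        ≡⟨ det≡ _ ⟩
      Z.det (λ i j → Func.to coefficients (ℤ.+ toℕ i ℤ.- ℤ.+ toℕ j))
        ≡⟨ Z.det-cong (λ i j → entry i j) ⟩
      Z.det (λ i j → Z.∑ (β (exp ⟨$⟩ʳ i) (exp ⟨$⟩ʳ j)))
        ≡⟨ Z.det-permute (λ x y → Z.∑ (β x y)) exp ⟩
      A ∎)
      where
      open ≡.≡-Reasoning
      -- Summation over s absorbs the twist s ↦ us in the equivariance. So the augmented blocks
      -- depend on x/y only, as a group matrix of F* requires.
      entry : ∀ i j → Func.to coefficients (ℤ.+ toℕ i ℤ.- ℤ.+ toℕ j) ≡ Z.∑ (β (exp ⟨$⟩ʳ i) (exp ⟨$⟩ʳ j))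
      entry i j = begin
        Z.∑ (β x y)
          ≡⟨ Z.∑-permute (β x y) (scale (exp ⟨$⟩ʳ j)) ⟩
        Z.∑ (λ s → β x y (suc (exp ⟨$⟩ʳ j) * s))
          ≡⟨ Z.∑-cong (equivariance (exp ⟨$⟩ʳ j) x y) ⟨
        Z.∑ (β (unit (exp ⟨$⟩ʳ j) ⟨$⟩ʳ x) (unit (exp ⟨$⟩ʳ j) ⟨$⟩ʳ y))
          ≡⟨ cong₂ (λ x y → Z.∑ (β x y)) (exp-difference i j) (exp-zero j) ⟩
        Z.∑ (β (exp ⟨$⟩ʳ i) (exp ⟨$⟩ʳ j)) ∎
        where
        x = exp ⟨$⟩ʳ residue (ℤ.+ toℕ i ℤ.- ℤ.+ toℕ j)
        y = exp ⟨$⟩ʳ residue 0ℤ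

-- Transport of a finite field to `Fin q` and coordinates on GA(1,q)

module FiniteHeytingField {c ℓ₁ ℓ₂} (K : HeytingField c ℓ₁ ℓ₂) {N : ℕ}
  (e : HasOrder K (suc N)) (to-zero : HeytingField._≈_ K (Inverse.to e zero) (HeytingField.0# K)) where

  private
    module K = HeytingField K
    KR : CommutativeRing c ℓ₁
    KR = HeytingCommutativeRing.commutativeRing K.heytingCommutativeRing
    module KR = CommutativeRing KR
  open HeytingProperties K.heytingCommutativeRing using (x-0≈x; 1#0; invertibleˡ⇒#)
  open Inverse e using (to; from)
  open import Algebra.Properties.Ring KR.ring using (-‿distribʳ-*)

  to-from : ∀ x → to (from x) K.≈ x
  to-from = Inverse.strictlyInverseˡ e

  to-cong : ∀ {i j} → i ≡ j → to i K.≈ to j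
  to-cong refl = K.refl

  to-injective : ∀ {i j} → to i K.≈ to j → i ≡ j
  to-injective {i} {j} eq = trans (sym (Inverse.strictlyInverseʳ e i))
    (trans (Inverse.from-cong e eq) (Inverse.strictlyInverseʳ e j))

  finRing : RawRing 0ℓ 0ℓ
  finRing = record
    { Carrier = Fin (suc N)
    ; _≈_ = _≡_
    ; _+_ = λ i j → from (to i K.+ to j)
    ; _*_ = λ i j → from (to i K.* to j)
    ; -_  = λ i → from (K.- to i)
    ; 0#  = zero
    ; 1#  = from K.1#
    }
  open RawRing finRing using (_*_; 1#)

  isRingMonomorphism : IsRingMonomorphism finRing KR.rawRing to
  isRingMonomorphism = record
    { isRingHomomorphism = homomorphism to-cong
        (λ _ _ → to-from _) (λ _ _ → to-from _) (λ _ → to-from _) to-zero (to-from _)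
    ; injective = to-injective
    }

  opaque
    isCommutativeRing : IsCommutativeRing _≡_ (RawRing._+_ finRing) _*_ (RawRing.-_ finRing) zero 1#
    isCommutativeRing = RingMonomorphism.isCommutativeRing isRingMonomorphism KR.isCommutativeRing

  opaque
    -- Tightness of # turns the failure of the finite search for an inverse into an equality.
    inverse : ∀ i → ∃[ y ] y * suc i ≡ 1#
    inverse i with Fin.any? (λ y → y * suc i Fin.≟ 1#)
    ... | yes found = found
    ... | no ¬found = contradiction
      (to-injective (K.trans (proj₁ (K.tight _ _) ¬#) (K.sym to-zero))) λ ()
      where
      ¬# : ¬ to (suc i) K.# K.0#
      ¬# i#0 with K.#⇒invertible i#0
      ... | y , yx≈1 , _ = ¬found (from y , Inverse.from-cong e
        (K.trans (K.*-cong (to-from y) (K.sym (x-0≈x _))) yx≈1))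

    -- The inverse found by the search is converted back into apartness from 0, which an affine
    -- matrix carries as data.
    suc#0 : ∀ i → to (suc i) K.# K.0#
    suc#0 i = let y , yi≡1 = inverse i in invertibleˡ⇒# (to y , (begin
      to y K.* (to (suc i) K.- K.0#)   ≈⟨ K.*-congˡ (x-0≈x _) ⟩
      to y K.* to (suc i)              ≈⟨ to-from _ ⟨
      to (y * suc i)                   ≈⟨ to-cong yi≡1 ⟩
      to 1#                            ≈⟨ to-from _ ⟩
      K.1#                             ∎))
      where open ≈-Reasoning KR.setoid

    1≢0 : 1# ≢ zero
    1≢0 1≡0 = proj₂ (K.tight K.1# K.0#)
      (K.trans (K.sym (to-from K.1#)) (K.trans (to-cong 1≡0) to-zero)) 1#0

  open FiniteField isCommutativeRing inverse
  open CyclicDeterminant isCommutativeRing inverse 1≢0 using (isCyclicDeterminant)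
  open Affine K using (inv; inv-*)
  private
    module G = Group (GA₁ K)

  γ : Fin q → Fin N → AffineMatrix K
  γ s x = affine (to (suc x)) (to (suc x F.* s)) (suc#0 x)

  pred : ∀ (i : Fin q) → i ≢ zero → Fin N
  pred zero    i≢0 = contradiction refl i≢0
  pred (suc i) i≢0 = i

  suc-pred : ∀ (i : Fin q) (i≢0 : i ≢ zero) → suc (pred i i≢0) ≡ i
  suc-pred zero    i≢0 = contradiction refl i≢0
  suc-pred (suc i) i≢0 = refl

  pred-cong : ∀ {i j i≢0 j≢0} → i ≡ j → pred i i≢0 ≡ pred j j≢0
  pred-cong {i} {_} {i≢0} {j≢0} refl = Fin.suc-injective (trans (suc-pred i i≢0) (sym (suc-pred i j≢0)))

  from≢0 : ∀ {a} → a K.# K.0# → from a ≢ zero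
  from≢0 {a} a#0 eq = proj₂ (K.tight a K.0#)
    (K.trans (K.sym (to-from a)) (K.trans (to-cong eq) to-zero)) a#0

  unit-part : AffineMatrix K → Fin N
  unit-part (affine a b a#0) = pred (from a) (from≢0 a#0)

  translation-part : AffineMatrix K → Fin q
  translation-part (affine a b a#0) = from (inv a#0 K.* b)

  γ-surjective : ∀ M → γ (translation-part M) (unit-part M) G.≈ M
  γ-surjective (affine a b a#0) = a≈ , (begin
    to (suc x F.* s)                 ≈⟨ to-from _ ⟩
    to (suc x) K.* to s              ≈⟨ K.*-cong a≈ (to-from _) ⟩
    a K.* (inv a#0 K.* b)            ≈⟨ K.*-assoc _ _ _ ⟨
    a K.* inv a#0 K.* b              ≈⟨ K.*-congʳ (K.trans (KR.*-comm _ _) (inv-* a#0)) ⟩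
    K.1# K.* b                       ≈⟨ K.*-identityˡ b ⟩
    b                                ∎)
    where
    open ≈-Reasoning KR.setoid
    x = unit-part (affine a b a#0)
    s = translation-part (affine a b a#0)
    a≈ : to (suc x) K.≈ a
    a≈ = K.trans (to-cong (suc-pred (from a) (from≢0 a#0))) (to-from a)

  unit-part-cong : ∀ {M L} → M G.≈ L → unit-part M ≡ unit-part L
  unit-part-cong (a≈ , b≈) = pred-cong (Inverse.from-cong e a≈)

  translation-part-cong : ∀ {M L} → M G.≈ L → translation-part M ≡ translation-part L
  translation-part-cong {M} {L} M≈L@(a≈ , b≈) = Inverse.from-cong e
    (K.*-cong (proj₁ (G.⁻¹-cong {M} {L} M≈L)) b≈)

  inv-*-cancel : ∀ {a} (a#0 : a K.# K.0#) x → inv a#0 K.* (a K.* x) K.≈ x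
  inv-*-cancel a#0 x = K.trans (K.sym (K.*-assoc _ _ _))
    (K.trans (K.*-congʳ (inv-* a#0)) (K.*-identityˡ x))

  unit-part-γ : ∀ s x → unit-part (γ s x) ≡ x
  unit-part-γ s x = pred-cong {i≢0 = from≢0 (suc#0 x)} {j≢0 = λ ()} (Inverse.strictlyInverseʳ e (suc x))

  translation-part-γ : ∀ s x → translation-part (γ s x) ≡ s
  translation-part-γ s x = to-injective (K.trans (to-from _)
    (K.trans (K.*-congˡ (to-from _)) (inv-*-cancel (suc#0 x) (to s))))

  GA-enumeration : Enumeration (q ℕ.* N) G.setoid
  GA-enumeration = record
    { to = γ′
    ; from = index
    ; to-cong = λ { {x = k} refl → G.refl {γ′ k} }
    ; from-cong = index-cong
    ; inverse = (λ { {M} refl → γ′-index M })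
              , (λ {k} {M} M≈ → trans (index-cong {M} {γ′ k} M≈) (index-γ′ k))
    }
    where
    γ′ : Fin (q ℕ.* N) → AffineMatrix K
    γ′ k = γ (quotient {q} N k) (remainder {q} N k)
    index : AffineMatrix K → Fin (q ℕ.* N)
    index M = combine (translation-part M) (unit-part M)
    index-cong : ∀ {M L} → M G.≈ L → index M ≡ index L
    index-cong {M} {L} M≈L = cong₂ (combine {q} {N}) (translation-part-cong {M} {L} M≈L) (unit-part-cong {M} {L} M≈L)
    γ′-index : ∀ M → γ′ (index M) G.≈ M
    γ′-index M = subst (λ sx → γ (proj₁ sx) (proj₂ sx) G.≈ M)
      (sym (Fin.remQuot-combine (translation-part M) (unit-part M))) (γ-surjective M)
    index-γ′ : ∀ k → index (γ′ k) ≡ k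
    index-γ′ k = trans (cong₂ (combine {q} {N}) (translation-part-γ s x) (unit-part-γ s x))
                       (Fin.combine-remQuot {q} N k)
      where
      s = quotient {q} N k
      x = remainder {q} N k

  to-difference : ∀ s t → to (s F.- t) K.≈ to s K.- to t
  to-difference s t = K.trans (to-from _) (K.+-congˡ (to-from _))

  -- This is the purpose of the coordinates (x, xs): the other entry of the quotient, x/y, does not
  -- involve s and t, so for fixed x and y the group element depends on s - t alone, as in a
  -- convolution.
  γ-quotient : ∀ s x t y → AffineMatrix.b (γ s x G.∙ γ t y G.⁻¹) K.≈ to (suc x) K.* (to s K.- to t)
  γ-quotient s x t y = begin
    X K.* (K.- (inv (suc#0 y) K.* to (suc y F.* t))) K.+ to (suc x F.* s)
      ≈⟨ K.+-cong (K.*-congˡ (K.-‿cong (K.trans (K.*-congˡ (to-from _)) (inv-*-cancel (suc#0 y) (to t))))) (to-from _) ⟩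
    X K.* (K.- to t) K.+ X K.* to s
      ≈⟨ K.distribˡ _ _ _ ⟨
    X K.* (K.- to t K.+ to s)
      ≈⟨ K.*-congˡ (K.+-comm _ _) ⟩
    X K.* (to s K.- to t) ∎
    where
    open ≈-Reasoning KR.setoid
    X = to (suc x)

  module _ (a : Coefficients (GA₁ K)) where

    β : Fin N → Fin N → Element
    β x y s = Func.to a (γ s x G.∙ γ zero y G.⁻¹)

    regular-β : ∀ k l → regular β k l ≡
      Func.to a (Inverse.to GA-enumeration k G.∙ Inverse.to GA-enumeration l G.⁻¹)
    regular-β k l = Func.cong a (K.refl , (begin
      _                                         ≈⟨ γ-quotient (s F.- t) x zero y ⟩
      X K.* (to (s F.- t) K.- to zero)          ≈⟨ K.*-congˡ (K.trans (K.+-congˡ (K.-‿cong to-zero)) (x-0≈x _)) ⟩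
      X K.* to (s F.- t)                        ≈⟨ K.*-congˡ (to-difference s t) ⟩
      X K.* (to s K.- to t)                     ≈⟨ γ-quotient s x t y ⟨
      _                                         ∎))
      where
      open ≈-Reasoning KR.setoid
      s = quotient {q} N k
      x = remainder {q} N k
      t = quotient {q} N l
      y = remainder {q} N l
      X = to (suc x)

    private
      equivariance : ∀ i x y s → β (unit i ⟨$⟩ʳ x) (unit i ⟨$⟩ʳ y) s ≡ β x y (suc i F.* s)
      equivariance i x y s = Func.cong a (K.sym quotients≈ , (begin
        _                                              ≈⟨ γ-quotient s (unit i ⟨$⟩ʳ x) zero (unit i ⟨$⟩ʳ y) ⟩
        to (suc (unit i ⟨$⟩ʳ x)) K.* (to s K.- to zero) ≈⟨ K.*-cong (to-unit x) (K.trans (K.+-congˡ (K.-‿cong to-zero)) (x-0≈x _)) ⟩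
        U K.* X K.* to s                               ≈⟨ K.*-congʳ (KR.*-comm U X) ⟩
        X K.* U K.* to s                               ≈⟨ K.*-assoc X U (to s) ⟩
        X K.* (U K.* to s)                             ≈⟨ K.*-congˡ (to-from _) ⟨
        X K.* to (suc i F.* s)                         ≈⟨ K.*-congˡ (K.trans (K.+-congˡ (K.-‿cong to-zero)) (x-0≈x _)) ⟨
        X K.* (to (suc i F.* s) K.- to zero)           ≈⟨ γ-quotient (suc i F.* s) x zero y ⟨
        _                                              ∎))
        where
        open ≈-Reasoning KR.setoid
        U = to (suc i)
        X = to (suc x)
        Y = to (suc y)
        W = to (suc (unit i ⟨$⟩ʳ y))
        w#0 = suc#0 (unit i ⟨$⟩ʳ y)
        to-unit : ∀ x → to (suc (unit i ⟨$⟩ʳ x)) K.≈ U K.* to (suc x)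
        to-unit x = K.trans (to-cong (suc-unit i x)) (to-from _)
        quotients≈ : X K.* inv (suc#0 y) K.≈ to (suc (unit i ⟨$⟩ʳ x)) K.* inv w#0
        quotients≈ = begin
          X K.* inv (suc#0 y)                            ≈⟨ K.*-identityʳ _ ⟨
          X K.* inv (suc#0 y) K.* K.1#                   ≈⟨ K.*-congˡ (inv-* w#0) ⟨
          X K.* inv (suc#0 y) K.* (inv w#0 K.* W)        ≈⟨ K.*-congˡ (K.trans (KR.*-comm _ _) (K.*-congʳ (to-unit y))) ⟩
          X K.* inv (suc#0 y) K.* (U K.* Y K.* inv w#0)  ≈⟨ K.*-assoc _ _ _ ⟨
          X K.* inv (suc#0 y) K.* (U K.* Y) K.* inv w#0  ≈⟨ K.*-congʳ (begin
            X K.* inv (suc#0 y) K.* (U K.* Y)    ≈⟨ K.*-assoc _ _ _ ⟩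
            X K.* (inv (suc#0 y) K.* (U K.* Y))  ≈⟨ K.*-congˡ (K.*-congˡ (KR.*-comm U Y)) ⟩
            X K.* (inv (suc#0 y) K.* (Y K.* U))  ≈⟨ K.*-congˡ (inv-*-cancel (suc#0 y) U) ⟩
            X K.* U                              ≈⟨ KR.*-comm X U ⟩
            U K.* X                              ≈⟨ to-unit x ⟨
            to (suc (unit i ⟨$⟩ʳ x))             ∎) ⟩
          to (suc (unit i ⟨$⟩ʳ x)) K.* inv w#0   ∎

    β-equivariant : Equivariant β
    β-equivariant = record { equivariance = equivariance }

    open Factors β-equivariant

    groupDeterminant-GA : groupDeterminant (GA₁ K) GA-enumeration a ≡ A ℤ.* B ℤ.^ N
    groupDeterminant-GA = trans (det≡ _) (trans
      (sym (Z.det-cong {M = regular β} regular-β)) (det-regular≡AB^N 1≢0))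

    factorisation : ∀ {n} (h : Enumeration n G.setoid) → ∃₂ λ A B →
      IsIntegerGroupDeterminant (ℤ/ N) A × B ≡ A [mod suc N ] ×
      groupDeterminant (GA₁ K) h a ≡ A ℤ.* B ℤ.^ N
    factorisation h = A , B
      , isCyclicDeterminant β-equivariant
      , ℤ∣.divides (ℤ.- C 1#) B-A
      , trans (groupDeterminant-invariant (GA₁ K) h GA-enumeration a) groupDeterminant-GA

-- A transposition moves the index of 0 to `zero`, which the identification of units with successors
-- presupposes.
normalise-zero : ∀ {c ℓ₁ ℓ₂} (K : HeytingField c ℓ₁ ℓ₂) {N} → HasOrder K (suc N) →
  Σ[ e ∈ HasOrder K (suc N) ] HeytingField._≈_ K (Inverse.to e zero) (HeytingField.0# K)
normalise-zero K e =
  Composition.inverse (Perm.transpose zero z) e , K.trans (Inverse.to-cong e transposed) (Inverse.strictlyInverseˡ e K.0#)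
  where
  module K = HeytingField K
  z = Inverse.from e K.0#
  transposed : Perm.transpose zero z ⟨$⟩ʳ zero ≡ z
  transposed = refl

theorem1 : ∀ {c ℓ₁ ℓ₂} (p k : ℕ) → Prime p → k ≥ 1 →
    let q = p ^ k in
    (F : HeytingField c ℓ₁ ℓ₂) → HasOrder F q →
    (D : ℤ) → IsIntegerGroupDeterminant (GA₁ F) D →
    ∃₂ λ A B → IsIntegerGroupDeterminant (ℤ/ (q ∸ 1)) A
    × B ≡ A [mod q ]
    × D ≡ A ℤ.* (B ℤ.^ (q ∸ 1))
theorem1 p k _ _ F e D (n , h , a , D≡) = factorise-order (p ^ k) e
  where
  -- With the order as a variable it can be matched as `suc N`, whereupon `q ∸ 1` computes to `N`.
  -- Order 0 is impossible, since the element 0 of the field has an index.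
  factorise-order : ∀ q → HasOrder F q →
    ∃₂ λ A B → IsIntegerGroupDeterminant (ℤ/ (q ∸ 1)) A × B ≡ A [mod q ] × D ≡ A ℤ.* (B ℤ.^ (q ∸ 1))
  factorise-order zero e = contradiction (Inverse.from e (HeytingField.0# F)) λ ()
  factorise-order (suc N) e =
    let e′ , to-zero = normalise-zero F e
        A , B , isA , B≡A , det≡AB = FiniteHeytingField.factorisation F e′ to-zero a h
    in A , B , isA , B≡A , trans D≡ det≡AB
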